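{- Let $G$ be a finite undirected graph (multiple edges and loops allowed). Fix a reference orientation $O_{\mathrm{ref}}$ of $G$, a total order $<$ on $E(G)$, and arbitrary sign labels $\sigma_u,\sigma_b\colon E(G)\to\{+,-\}$. Then there exists a $2^{|E(G)|}$-to-one surjection $\varphi\colon\mathcal{O}^4(G)\to\mathcal{S}(G)$ such that: (a) the map $O\mapsto(\varphi(O),O^o)$ is a bijection between $\mathcal{O}^4(G)$ and $\mathcal{S}(G)\times\mathcal{S}(G)$; (b) $O^u\cap\varphi(O)=\varnothing$ and $O^b\subseteq\varphi(O)$ for all $O\in\mathcal{O}^4(G)$; (c) setting $I(O):=\hat I(\varphi(O))$ and $L(O):=\hat L(\varphi(O))$, where $\hat I,\hat L$ are the generalized activities with respect to $<$, the resulting maps $I,L\colon\mathcal{O}^4(G)\to\mathcal{S}(G)$ satisfy, for every $O\in\mathcal{O}^4(G)$, $I(O)\cap O^o=I^o(O)$, $I(O)\cap O^u=I^u(O)$, $L(O)\cap O^o=L^o(O)$ and $L(O)\cap O^b=L^b(O)$, where $I^o(O),I^u(O),L^o(O),L^b(O)$ are the sets defined in the context; (d) with $I^{\pm}(O):=I(O)\cap O^{\pm}$ and $L^{\pm}(O):=L(O)\cap O^{\pm}$, we have $I^+(O)\subseteq\varphi(O)$, $I^-(O)\cap\varphi(O)=\varnothing$, $L^-(O)\subseteq\varphi(O)$ and $L^+(O)\cap\varphi(O)=\varnothing$ for all $O\in\mathcal{O}^4(G)$; (e) if $O^o=\varnothing$ then $I(O)=\hat I(O^b)$ and $L(O)=\hat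 L(O^b)$.
   Context: $\mathcal{S}(G):=2^{E(G)}$ is the set of spanning subgraphs of $G$, identified with subsets of $E(G)$. A reference orientation $O_{\mathrm{ref}}$ chooses for each edge $e=\{a,b\}$ a positive direction $e^+=(a,b)$ and hence a negative direction $e^-=(b,a)$; $e^+$ and $e^-$ are distinct formal symbols even when $e$ is a loop. Put $\mathbb{E}(G):=\{e^+,e^-\colon e\in E(G)\}$. A fourientation of $G$ is an arbitrary subset $O\subseteq\mathbb{E}(G)$; $\mathcal{O}^4(G)$ is the set of all fourientations. In $O$ an edge $e$ is unoriented if $\{e^+,e^-\}\cap O=\varnothing$, bioriented if $\{e^+,e^-\}\subseteq O$, and oriented otherwise. $O^u,O^b,O^o\subseteq E(G)$ denote the sets of unoriented, bioriented and oriented edges; $O^+$ (resp. $O^-$) is the set of oriented edges $e\in O^o$ with $e^+\in O$ (resp. $e^-\in O$). A cut of $G$ is a minimal nonempty set of edges whose removal increases the number of connected components; it is the set of edges joining some $X\subset V(G)$ to its complement, and has two consistent orientations (out of $X$, into $X$). A cycle is (the edge set of) a simple cycle of $G$ (a loop is a cycle of length one), and has two consistent orientations. A directed cut (cycle) $C$ is a cut (cycle) with one of its two consistent orientations chosen; $\mathbb{E}(C)\subseteq\mathbb{E}(G)$ is its set of directed edges. A directed cut $Cu$ is a potential cut of a fourientation $O$ if $e^\delta\in\mathbb{E}(Cu)$ implies $e^{ -\delta}\notin O$ (for $\delta\in\{+,-\}$). A directed cycle $Cy$ is a potential cycle of $O$ if $e^\delta\in\mathbb{E}(Cy)$ implies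 $e^\delta\in O$. "Min edge" means minimum with respect to $<$. For $O\in\mathcal{O}^4(G)$ define $I^o(O):=\{e\in O^o\colon e$ is the min edge in some potential cut of $O\}$; $L^o(O):=\{e\in O^o\colon e$ is the min edge in some potential cycle of $O\}$; $I^u(O):=\{e\in O^u\colon e$ is the min edge in some potential cut of $O\cup\{e^{\sigma_u(e)}\}\}$; $L^b(O):=\{e\in O^b\colon e$ is the min edge in some potential cycle of $O\setminus\{e^{\sigma_b(e)}\}\}$. Generalized activities of subgraphs: for $S\in\mathcal{S}(G)$, $\hat I(S)$ is the set of edges $e\in E(G)$ such that $e$ is the min edge of some cut of $G$ disjoint from $S\setminus\{e\}$, and $\hat L(S)$ is the set of edges $e\in E(G)$ such that $e$ is the min edge of some cycle of $G$ contained in $S\cup\{e\}$. -}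

module Defs where

open import Data.Bool.Base using (_xor_)
open import Data.Fin.Base using (Fin)
open import Data.Fin.Subset
  using (Subset; _∈_; _∉_; _⊆_; _∩_; _∪_; _-_; ∁; ⊤; ⁅_⁆; Nonempty; Empty)
open import Data.List.Base using (List; []; _∷_; map)
import Data.List.Membership.Propositional as List
open import Data.List.Relation.Unary.Unique.Propositional using (Unique)
open import Data.Nat.Base using (ℕ; _<_)
open import Data.Product.Base using (_×_; _,_; proj₁; proj₂; Σ-syntax; ∃-syntax)
open import Data.Sign.Base using (Sign; opposite)
open import Data.Sum.Base using (_⊎_)
open import Data.Vec.Base using (lookup; tabulate)
open import Function.Base using (id; _∘_)
open import Function.Bundles using (_⇔_)
open import Function.Definitions using (Surjective)
open import Level using (0ℓ)
open import Relation.Binary.Construct.Closure.ReflexiveTransitive using (Star)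
open import Relation.Binary.Core using (Rel)
open import Relation.Binary.PropositionalEquality.Core using (_≡_; _≢_)
open import Relation.Nullary.Negation.Core using (¬_)
open import Relation.Unary using (Pred)

-- Finite undirected multigraphs with vertex set Fin n and edge set Fin m.
-- The pair `ends e` represents an unordered pair: it is only used through
-- notions that are symmetric in its two components.  Spanning subgraphs are
-- elements of `Subset m`.

record Graph (n m : ℕ) : Set where
  field
    ends : Fin m → Fin n × Fin n

  Joins : Fin m → Fin n → Fin n → Set
  Joins e u v = ends e ≡ (u , v) ⊎ ends e ≡ (v , u)

-- The arc (e , +) is the formal symbol e⁺ and (e , -) is e⁻; in particular
-- these are distinct also when e is a loop.

Arc : ℕ → Set
Arc m = Fin m × Sign

-- e⁺ points from `tail e` to `head e`.

record ReferenceOrientation {n m : ℕ} (G : Graph n m) : Set where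
  open Graph G
  field
    tail head : Fin m → Fin n
    joins     : ∀ e → Joins e (tail e) (head e)

  source target : Arc m → Fin n
  source (e , Sign.+) = tail e
  source (e , Sign.-) = head e
  target (e , δ) = source (e , opposite δ)

-- A subset O of 𝔼(G), stored as pos = {e : e⁺ ∈ O} and neg = {e : e⁻ ∈ O}.

record Fourientation (m : ℕ) : Set where
  constructor fourientation
  field
    pos neg : Subset m

open Fourientation public

module _ {m : ℕ} where

  infix 4 _∈ᶠ_
  _∈ᶠ_ : Arc m → Fourientation m → Set
  (e , Sign.+) ∈ᶠ O = e ∈ pos O
  (e , Sign.-) ∈ᶠ O = e ∈ neg O

  insert remove : Arc m → Fourientation m → Fourientation m
  insert (e , Sign.+) O = fourientation (pos O ∪ ⁅ e ⁆) (neg O)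
  insert (e , Sign.-) O = fourientation (pos O) (neg O ∪ ⁅ e ⁆)
  remove (e , Sign.+) O = fourientation (pos O - e) (neg O)
  remove (e , Sign.-) O = fourientation (pos O) (neg O - e)

  infix 8 _ᵘ _ᵇ _ᵒ _⁺ _⁻
  _ᵘ _ᵇ _ᵒ _⁺ _⁻ : Fourientation m → Subset m
  O ᵘ = ∁ (pos O ∪ neg O)
  O ᵇ = pos O ∩ neg O
  O ᵒ = ∁ (O ᵘ ∪ O ᵇ)
  O ⁺ = O ᵒ ∩ pos O
  O ⁻ = O ᵒ ∩ neg O

  ⟦_⟧ : Subset m → Pred (Fin m) 0ℓ
  ⟦ S ⟧ e = e ∈ S

  IsMin : Rel (Fin m) 0ℓ → Pred (Fin m) 0ℓ → Fin m → Set
  IsMin _≺_ P e = P e × (∀ {f} → P f → f ≢ e → e ≺ f)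

-- Simple cycles, for undirected edges (Step = Fin m) and for arcs
-- (Step = Arc m) alike.  A walk is recorded as the list of its steps, each
-- paired with the vertex it starts from.  Distinctness of the edges only
-- matters for length two, where it excludes going back along the same edge.

module _ {n m : ℕ} {Step : Set}
         (edge : Step → Fin m) (Traverses : Step → Fin n → Fin n → Set) where

  data Walk : Fin n → List (Fin n × Step) → Fin n → Set where
    []  : ∀ {v} → Walk v [] v
    _∷_ : ∀ {u v w s ss} → Traverses s u v → Walk v ss w → Walk u ((u , s) ∷ ss) w

  record SimpleCycle : Set where
    field
      base              : Fin n
      steps             : List (Fin n × Step)
      walk              : Walk base steps base
      nonempty          : steps ≢ []
      vertices-distinct : Unique (map proj₁ steps)
      edges-distinct    : Unique (map (edge ∘ proj₂) steps)

    trace : List Step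
    trace = map proj₂ steps

    edges : List (Fin m)
    edges = map edge trace

module _ {n m : ℕ} (G : Graph n m) where
  open Graph G

  IsCycle : Subset m → Set
  IsCycle C = Σ[ c ∈ SimpleCycle id Joins ] (∀ e → e ∈ C ⇔ e List.∈ SimpleCycle.edges c)

  Adjacent : Subset m → Rel (Fin n) 0ℓ
  Adjacent S u v = ∃[ e ] e ∈ S × Joins e u v

  Connected : Subset m → Rel (Fin n) 0ℓ
  Connected S = Star (Adjacent S)

  -- The spanning subgraph S has exactly k connected components.
  record Components (S : Subset m) (k : ℕ) : Set where
    field
      component  : Fin n → Fin k
      surjective : Surjective _≡_ _≡_ component
      classes    : ∀ u v → component u ≡ component v ⇔ Connected S u v

  Disconnecting : Subset m → Set
  Disconnecting C =
    ∃[ k ] ∃[ k′ ] Components ⊤ k × Components (∁ C) k′ × k < k′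

  IsCut : Subset m → Set
  IsCut C = Nonempty C × Disconnecting C
          × (∀ D → Nonempty D → Disconnecting D → D ⊆ C → D ≡ C)

  -- The edges joining X to its complement.
  ∂ : Subset n → Subset m
  ∂ X = tabulate λ e → lookup X (proj₁ (ends e)) xor lookup X (proj₂ (ends e))

  module _ (_≺_ : Rel (Fin m) 0ℓ) where

    Î L̂ : Subset m → Pred (Fin m) 0ℓ
    Î S e = ∃[ C ] IsCut C × Empty (C ∩ (S - e)) × IsMin _≺_ ⟦ C ⟧ e
    L̂ S e = ∃[ C ] IsCycle C × C ⊆ S ∪ ⁅ e ⁆ × IsMin _≺_ ⟦ C ⟧ e

module _ {n m : ℕ} {G : Graph n m} (R : ReferenceOrientation G) where
  open ReferenceOrientation R

  -- The cut ∂ X oriented out of X.  The orientation into X is obtained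
  -- from the complement of X.
  record DirectedCut : Set where
    field
      side  : Subset n
      isCut : IsCut G (∂ G side)

    edges : Subset m
    edges = ∂ G side

    HasArc : Pred (Arc m) 0ℓ
    HasArc a = source a ∈ side × target a ∉ side

  DirectedCycle : Set
  DirectedCycle = SimpleCycle proj₁ λ a u v → source a ≡ u × target a ≡ v

  PotentialCut : Fourientation m → DirectedCut → Set
  PotentialCut O Cu =
    ∀ e δ → DirectedCut.HasArc Cu (e , δ) → ¬ ((e , opposite δ) ∈ᶠ O)

  PotentialCycle : Fourientation m → DirectedCycle → Set
  PotentialCycle O Cy =
    ∀ e δ → (e , δ) List.∈ SimpleCycle.trace Cy → (e , δ) ∈ᶠ O

  module _ (_≺_ : Rel (Fin m) 0ℓ) where

    MinOfPotentialCut MinOfPotentialCycle : Fourientation m → Pred (Fin m) 0ℓ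
    MinOfPotentialCut O e =
      ∃[ Cu ] PotentialCut O Cu × IsMin _≺_ ⟦ DirectedCut.edges Cu ⟧ e
    MinOfPotentialCycle O e =
      ∃[ Cy ] PotentialCycle O Cy × IsMin _≺_ (List._∈ SimpleCycle.edges Cy) e

    Iᵒ Lᵒ : Fourientation m → Pred (Fin m) 0ℓ
    Iᵒ O e = e ∈ O ᵒ × MinOfPotentialCut O e
    Lᵒ O e = e ∈ O ᵒ × MinOfPotentialCycle O e

    Iᵘ Lᵇ : (Fin m → Sign) → Fourientation m → Pred (Fin m) 0ℓ
    Iᵘ σᵘ O e = e ∈ O ᵘ × MinOfPotentialCut (insert (e , σᵘ e) O) e
    Lᵇ σᵇ O e = e ∈ O ᵇ × MinOfPotentialCycle (remove (e , σᵇ e) O) e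

{-# OPTIONS --safe #-}
-- The edges are processed from the largest to the smallest, and every oriented
-- edge e is either contracted (bioriented, e ∈ φ(O)) or deleted (unoriented,
-- e ∉ φ(O)).  An arc f^δ is the minimum of a potential cut iff it leaves a vertex
-- set X which is entered by no arc of O and crossed by no edge below f; it is
-- the minimum of a potential cycle iff it does not leave any X which is entered
-- by no arc of O above f.  In both cases f^δ is separated from a set D of arcs.
-- For fixed O these sets D, over all f and both kinds of activity, form a chain
-- under inclusion.  If e^+ separates an arc that is not separated once e is
-- contracted, by means of X, and e^- does so by means of Y, then e crosses
-- neither X ∩ Y nor X ∪ Y, and as the sets D are nested one of these separates
-- one of the two arcs even after contracting e.  Hence there is one direction
-- in which e can be deleted while its reverse is contracted, without changing
-- the activity of any smaller edge.  If no arc is sensitive to e, this freedom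
-- is used to satisfy (d).  Since the choice made at e depends on O only below e
-- and on φ(O) only above e, O is recovered from (φ(O), Oᵒ) in ascending order.

module Submission where

open import Axiom.UniquenessOfIdentityProofs using (module Decidable⇒UIP)
open import Defs
open import Data.Bool.Base using (Bool; true; false; not; _∧_; _∨_; _xor_)
open import Data.Bool.Properties using (¬-not)
import Data.Bool.Properties as Bool
import Data.Empty as Empty
open import Data.Fin.Base using (Fin; zero; suc)
open import Data.Fin.Induction using (spo-wellFounded; spo-noetherian)
open import Data.Fin.Properties using (_≟_; any?; all?; suc-injective; injective⇒≤; 2↔Bool; *↔×)
open import Data.Fin.Subset using (Subset; _∈_; _∉_; _⊆_; _⊃_; _∩_; _∪_; _─_; _-_; ∁; ⊤; ⊥; ⁅_⁆; ∣_∣; Nonempty; Empty)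
open import Data.Fin.Subset.Induction using (⊃-wellFounded)
open import Data.Fin.Subset.Properties
open import Data.List.Base using (List; []; _∷_; map)
import Data.List.Membership.Propositional as List
import Data.List.Membership.DecPropositional as DecList
open import Data.List.Membership.Propositional.Properties using (∈-map⁺; ∈-map⁻)
open import Data.List.Properties using (map-∘)
open import Data.List.Relation.Unary.All using (All; []; _∷_)
import Data.List.Relation.Unary.All as All
import Data.List.Relation.Unary.All.Properties as All
open import Data.List.Relation.Unary.AllPairs using ([]; _∷_)
open import Data.List.Relation.Unary.Any using (here; there)
open import Data.List.Relation.Unary.Unique.Propositional using (Unique)
open import Data.Nat.Base using (ℕ; _≤_; _<_; _^_)
open import Data.Nat.Properties using (<⇒≱)
import Data.Nat as ℕ
import Data.Nat.Properties as ℕ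
open import Data.Product.Base using (_×_; _,_; proj₁; proj₂; ∃-syntax; Σ-syntax)
open import Data.Product.Function.NonDependent.Propositional using (_×-↔_)
import Data.Product.Properties as Product
open import Data.Sign.Base using (Sign; opposite)
import Data.Sign.Properties as Sign
open import Data.Sum.Base using (_⊎_; inj₁; inj₂; [_,_]′)
import Data.Unit.Base as Unit
open import Data.Vec.Base using ([]; _∷_; here; there; Vec; lookup; tabulate)
open import Data.Vec.Properties using (lookup∘tabulate; lookup⇒[]=; []=⇒lookup; lookup-map; lookup-zipWith; tabulate-cong; tabulate∘lookup; lookup-replicate)
import Data.Vec.Properties as Vec
open import Function.Base using (id; _∘_; flip)
open import Function.Bundles using (_⇔_; mk⇔; Equivalence; _↔_; mk↔ₛ′)
open import Function.Definitions using (Injective; Surjective; Bijective)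
open import Function.Properties.Inverse using (↔-sym; ↔-trans)
open import Induction.WellFounded using (Acc; acc; WellFounded)
import Induction.WellFounded as WF
open import Level using (0ℓ)
open import Relation.Binary.Core using (Rel)
import Relation.Binary.Definitions as B
open import Relation.Binary.Construct.Closure.ReflexiveTransitive using (Star; _◅_; _◅◅_) renaming (ε to nil)
import Relation.Binary.Construct.Closure.ReflexiveTransitive as Star
open import Relation.Binary.PropositionalEquality
open import Relation.Binary.Structures using (IsEquivalence; IsStrictTotalOrder)
open import Relation.Nullary.Decidable using (Dec; yes; no; does; dec-true; _×-dec_; _⊎-dec_; _→-dec_; ¬?; map′; decidable-stable)
open import Relation.Nullary.Negation.Core using (¬_; contradiction)
open import Relation.Unary using (Pred; Decidable; _≐_)

open Equivalence using (to; from)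

-- Finite sets: decidable subsets, reachability, quotients and counting of classes

does⁻ : ∀ {P : Set} (P? : Dec P) → does P? ≡ true → P
does⁻ (yes p) _ = p

module _ {n : ℕ} {P : Pred (Fin n) 0ℓ} (P? : Decidable P) where

  select : Subset n
  select = tabulate (does ∘ P?)

  ∈-select⁺ : ∀ {x} → P x → x ∈ select
  ∈-select⁺ {x} px = lookup⇒[]= x _ (trans (lookup∘tabulate _ x) (dec-true (P? x) px))

  ∈-select⁻ : ∀ {x} → x ∈ select → P x
  ∈-select⁻ {x} x∈ = does⁻ (P? x) (trans (sym (lookup∘tabulate (does ∘ P?) x)) ([]=⇒lookup x∈))

abstract
  -- The set grows by one vertex as long as some step leaves it, and strict inclusion of subsets
  -- bounds this growth. Once no step leaves, closure under steps gives completeness.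
  reachable : ∀ {n} {R : Rel (Fin n) 0ℓ} → B.Decidable R → ∀ u →
              ∃[ X ] (∀ v → v ∈ X ⇔ Star R u v)
  reachable {n} {R} R? u =
    grow ⁅ u ⁆ (⊃-wellFounded _) (x∈⁅x⁆ u)
         (λ v∈u → subst (Star R u) (sym (x∈⁅y⁆⇒x≡y u v∈u)) nil)
    where
    grow : ∀ X → Acc _⊃_ X → u ∈ X → (∀ {v} → v ∈ X → Star R u v) →
           ∃[ X ] (∀ v → v ∈ X ⇔ Star R u v)
    grow X (acc rs) u∈X sound
      with any? (λ x → any? λ y → (x ∈? X ×-dec R? x y) ×-dec ¬? (y ∈? X))
    ... | yes (x , y , (x∈X , r) , y∉X) =
      grow (X ∪ ⁅ y ⁆)
           (rs (p⊆p∪q ⁅ y ⁆ , y , q⊆p∪q X ⁅ y ⁆ (x∈⁅x⁆ y) , y∉X))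
           (p⊆p∪q ⁅ y ⁆ u∈X)
           (λ v∈ → [ sound
                   , (λ v∈y → subst (Star R u) (sym (x∈⁅y⁆⇒x≡y y v∈y)) (sound x∈X ◅◅ r ◅ nil))
                   ]′ (x∈p∪q⁻ X ⁅ y ⁆ v∈))
    ... | no closed = X , λ v → mk⇔ sound (stays u∈X)
      where
      stays : ∀ {x y} → x ∈ X → Star R x y → y ∈ X
      stays x∈X nil = x∈X
      stays {x} x∈X (_◅_ {j = y} r rs) =
        stays (decidable-stable (y ∈? X) λ y∉X → closed (x , y , (x∈X , r) , y∉X)) rs

-- Induction on n: vertex 0 either joins the class of a later vertex or forms a new class, which is
-- numbered first.
quotient : ∀ {n} {_~_ : Rel (Fin n) 0ℓ} → IsEquivalence _~_ → B.Decidable _~_ →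
           ∃[ k ] Σ[ c ∈ (Fin n → Fin k) ]
             Surjective _≡_ _≡_ c × (∀ u v → c u ≡ c v ⇔ u ~ v)
quotient {ℕ.zero} _ _ = 0 , (λ ()) , (λ ()) , (λ ())
quotient {ℕ.suc n} {_~_} isEq ~?
  with quotient {n} {λ u v → suc u ~ suc v}
         (record { refl = IsEquivalence.refl isEq
                 ; sym = IsEquivalence.sym isEq
                 ; trans = IsEquivalence.trans isEq })
         (λ u v → ~? (suc u) (suc v))
     | any? (λ u → ~? zero (suc u))
... | k , c , surj , ker | yes (w , 0~w) = k , c′ , surj′ , ker′
  where
  module E = IsEquivalence isEq
  c′ : Fin (ℕ.suc n) → Fin k
  c′ zero    = c w
  c′ (suc u) = c u
  surj′ : Surjective _≡_ _≡_ c′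
  surj′ i = suc (proj₁ (surj i)) , λ { refl → proj₂ (surj i) refl }
  ker′ : ∀ u v → c′ u ≡ c′ v ⇔ u ~ v
  ker′ zero    zero    = mk⇔ (λ _ → E.refl) (λ _ → refl)
  ker′ zero    (suc v) = mk⇔ (λ eq → E.trans 0~w (to (ker w v) eq))
                             (λ 0~v → from (ker w v) (E.trans (E.sym 0~w) 0~v))
  ker′ (suc u) zero    = mk⇔ (λ eq → E.trans (to (ker u w) eq) (E.sym 0~w))
                             (λ u~0 → from (ker u w) (E.trans u~0 0~w))
  ker′ (suc u) (suc v) = ker u v
... | k , c , surj , ker | no 0≁ = ℕ.suc k , c′ , surj′ , ker′
  where
  module E = IsEquivalence isEq
  c′ : Fin (ℕ.suc n) → Fin (ℕ.suc k)
  c′ zero    = zero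
  c′ (suc u) = suc (c u)
  surj′ : Surjective _≡_ _≡_ c′
  surj′ zero    = zero , λ { refl → refl }
  surj′ (suc i) = suc (proj₁ (surj i)) , λ { refl → cong suc (proj₂ (surj i) refl) }
  ker′ : ∀ u v → c′ u ≡ c′ v ⇔ u ~ v
  ker′ zero    zero    = mk⇔ (λ _ → E.refl) (λ _ → refl)
  ker′ zero    (suc v) = mk⇔ (λ ()) (λ 0~v → contradiction (v , 0~v) 0≁)
  ker′ (suc u) zero    = mk⇔ (λ ()) (λ u~0 → contradiction (u , E.sym u~0) 0≁)
  ker′ (suc u) (suc v) = mk⇔ (to (ker u v) ∘ suc-injective) (cong suc ∘ from (ker u v))

module _ {n k k′ : ℕ} {c : Fin n → Fin k} {c′ : Fin n → Fin k′} where

  -- One representative for each class of `c` gives an injection into the classes of `c′`.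
  finer⇒≤ : Surjective _≡_ _≡_ c → (∀ u v → c′ u ≡ c′ v → c u ≡ c v) → k ≤ k′
  finer⇒≤ surj finer = injective⇒≤ {f = λ i → c′ (proj₁ (surj i))} λ {i} {j} eq →
    trans (sym (proj₂ (surj i) refl)) (trans (finer _ _ eq) (proj₂ (surj j) refl))

  -- Representatives of the classes of `c` occupy distinct classes of `c′`. The class of `c` that
  -- contains s and t has only one representative, so the class of s or that of t under `c′` is
  -- missed and provides the additional value.
  strictly-finer⇒< : Surjective _≡_ _≡_ c → (∀ u v → c′ u ≡ c′ v → c u ≡ c v) →
                     ∀ {s t} → c s ≡ c t → c′ s ≢ c′ t → k < k′
  strictly-finer⇒< surj finer {s} {t} cs≡ct c′s≢c′t = injective⇒≤ {f = f} f-injective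
    where
    r : Fin k → Fin n
    r i = proj₁ (surj i)

    c∘r : ∀ i → c (r i) ≡ i
    c∘r i = proj₂ (surj i) refl

    missed : ∃[ p ] (∀ i → c′ (r i) ≢ p)
    missed with c′ (r (c s)) ≟ c′ s
    ... | yes eq = c′ t , λ i eq′ → c′s≢c′t (trans (sym eq) (trans
            (cong (c′ ∘ r) (trans cs≡ct (trans (sym (finer _ _ eq′)) (c∘r i)))) eq′))
    ... | no neq = c′ s , λ i eq′ → neq (trans
            (cong (c′ ∘ r) (trans (sym (finer _ _ eq′)) (c∘r i))) eq′)

    f : Fin (ℕ.suc k) → Fin k′
    f zero    = proj₁ missed
    f (suc i) = c′ (r i)

    f-injective : ∀ {i j} → f i ≡ f j → i ≡ j
    f-injective {zero}  {zero}  eq = refl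
    f-injective {zero}  {suc j} eq = contradiction (sym eq) (proj₂ missed j)
    f-injective {suc i} {zero}  eq = contradiction eq (proj₂ missed i)
    f-injective {suc i} {suc j} eq =
      cong suc (trans (sym (c∘r i)) (trans (finer _ _ eq) (c∘r j)))

-- Signs, arcs and the boundary of a vertex set

opposite-involutive : ∀ δ → opposite (opposite δ) ≡ δ
opposite-involutive Sign.+ = refl
opposite-involutive Sign.- = refl

δ≡⊎opposite : ∀ (δ δ′ : Sign) → δ′ ≡ δ ⊎ δ′ ≡ opposite δ
δ≡⊎opposite Sign.+ Sign.+ = inj₁ refl
δ≡⊎opposite Sign.+ Sign.- = inj₂ refl
δ≡⊎opposite Sign.- Sign.+ = inj₂ refl
δ≡⊎opposite Sign.- Sign.- = inj₁ refl

reverse : ∀ {m} → Arc m → Arc m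
reverse (e , δ) = e , opposite δ

same-edge : ∀ {m} {a b : Arc m} → proj₁ b ≡ proj₁ a → b ≡ a ⊎ b ≡ reverse a
same-edge {a = e , δ} {e , δ′} refl with δ≡⊎opposite δ δ′
... | inj₁ refl = inj₁ refl
... | inj₂ refl = inj₂ refl

module Arcs {n m : ℕ} {G : Graph n m} (R : ReferenceOrientation G) where
  open Graph G
  open ReferenceOrientation R

  infix 4 _exits_
  _exits_ : Arc m → Subset n → Set
  a exits X = source a ∈ X × target a ∉ X

  target-reverse : ∀ a → target (reverse a) ≡ source a
  target-reverse (e , δ) = cong (λ δ → source (e , δ)) (opposite-involutive δ)

  joins⇒arc : ∀ {e u v} → Joins e u v → ∃[ δ ] source (e , δ) ≡ u × target (e , δ) ≡ v
  joins⇒arc {e} (inj₁ p) with joins e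
  ... | inj₁ q = Sign.+ , Product.,-injective (trans (sym q) p)
  ... | inj₂ q = Sign.- , Product.,-injective (trans (sym q) p)
  joins⇒arc {e} (inj₂ p) with joins e
  ... | inj₁ q = Sign.- , let h , t = Product.,-injective (trans (sym q) p) in t , h
  ... | inj₂ q = Sign.+ , let h , t = Product.,-injective (trans (sym q) p) in t , h

  arc⇒joins : ∀ e δ → Joins e (source (e , δ)) (target (e , δ))
  arc⇒joins e Sign.+ = joins e
  arc⇒joins e Sign.- = [ inj₂ , inj₁ ]′ (joins e)

  -- Together with `∈∂⁻`, this replaces the `xor` over unordered ends by an arc that leaves X, so
  -- that cuts can be treated through arcs alone.
  ∈∂⁺ : ∀ {X} e δ → (e , δ) exits X → e ∈ ∂ G X
  ∈∂⁺ {X} e δ (s∈X , t∉X) =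
    lookup⇒[]= e _ (trans (lookup∘tabulate _ e) (crosses (arc⇒joins e δ)))
    where
    out : lookup X (target (e , δ)) ≡ false
    out with lookup X (target (e , δ)) in eq
    ... | true  = contradiction (lookup⇒[]= _ X eq) t∉X
    ... | false = refl
    crosses : Joins e (source (e , δ)) (target (e , δ)) →
              (lookup X (proj₁ (ends e)) xor lookup X (proj₂ (ends e))) ≡ true
    crosses (inj₁ p) rewrite p | []=⇒lookup s∈X | out = refl
    crosses (inj₂ p) rewrite p | []=⇒lookup s∈X | out = refl

  ∈∂⁻ : ∀ {X} e → e ∈ ∂ G X → ∃[ δ ] (e , δ) exits X
  ∈∂⁻ {X} e e∈
    with lookup X (proj₁ (ends e)) in p | lookup X (proj₂ (ends e)) in q
       | trans (sym (lookup∘tabulate (λ e → lookup X (proj₁ (ends e)) xor lookup X (proj₂ (ends e))) e))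
               ([]=⇒lookup e∈)
  ... | true  | true  | ()
  ... | false | false | ()
  ... | true  | false | eq with joins⇒arc {e} (inj₁ refl)
  ...   | δ , s , t = δ , subst (_∈ X) (sym s) (lookup⇒[]= _ X p) ,
                      λ t∈ → contradiction (trans (sym q) ([]=⇒lookup (subst (_∈ X) t t∈))) λ ()
  ∈∂⁻ {X} e e∈ | false | true | eq with joins⇒arc {e} (inj₂ refl)
  ...   | δ , s , t = δ , subst (_∈ X) (sym s) (lookup⇒[]= _ X q) ,
                      λ t∈ → contradiction (trans (sym p) ([]=⇒lookup (subst (_∈ X) t t∈))) λ ()

-- Cuts

x∈p─q⇒x∉q : ∀ {n} {p q : Subset n} {x} → x ∈ p ─ q → x ∉ q
x∈p─q⇒x∉q {p = _ ∷ _} {q = true ∷ _}  {zero}  () here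
x∈p─q⇒x∉q {p = _ ∷ _} {q = _ ∷ _} {suc x} (there x∈) (there x∈q) = x∈p─q⇒x∉q x∈ x∈q

module _ {n m : ℕ} (G : Graph n m) where
  open Graph G

  joins-sym : ∀ {e u v} → Joins e u v → Joins e v u
  joins-sym = [ inj₂ , inj₁ ]′

  joins? : ∀ e → B.Decidable (Joins e)
  joins? e u v = ≡-dec (ends e) (u , v) ⊎-dec ≡-dec (ends e) (v , u)
    where ≡-dec = Product.≡-dec _≟_ _≟_

  connected-isEquivalence : ∀ S → IsEquivalence (Connected G S)
  connected-isEquivalence S = record
    { refl  = nil
    ; sym   = Star.reverse λ (e , e∈S , j) → e , e∈S , joins-sym j
    ; trans = _◅◅_
    }

  module Connected≈ (S : Subset m) = IsEquivalence (connected-isEquivalence S)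

  adjacent? : ∀ S → B.Decidable (Adjacent G S)
  adjacent? S u v = any? λ e → e ∈? S ×-dec joins? e u v

  cluster : Subset m → Fin n → Subset n
  cluster S u = proj₁ (reachable (adjacent? S) u)

  ∈cluster⇔ : ∀ {S u v} → v ∈ cluster S u ⇔ Connected G S u v
  ∈cluster⇔ {S} {u} {v} = proj₂ (reachable (adjacent? S) u) v

  connected? : ∀ S → B.Decidable (Connected G S)
  connected? S u v = map′ (to ∈cluster⇔) (from ∈cluster⇔) (v ∈? cluster S u)

  connected-join : ∀ {S S′} → (∀ {e u v} → e ∈ S → Joins e u v → Connected G S′ u v) →
                   ∀ {u v} → Connected G S u v → Connected G S′ u v
  connected-join f nil = nil
  connected-join f ((e , e∈S , j) ◅ rs) = f e∈S j ◅◅ connected-join f rs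

  connected-mono : ∀ {S S′} → S ⊆ S′ → ∀ {u v} → Connected G S u v → Connected G S′ u v
  connected-mono S⊆S′ = Star.map λ (e , e∈S , j) → e , S⊆S′ e∈S , j

  components : ∀ S → ∃[ k ] Components G S k
  components S with quotient (connected-isEquivalence S) (connected? S)
  ... | k , c , surj , ker = k , record { component = c ; surjective = surj ; classes = ker }

  module _ {D : Subset m} where
    open Components

    -- Every component of G then lies inside one component of G - D, so the removal of D creates no
    -- component.
    connecting⇒¬disconnecting : (∀ {u v} → Connected G ⊤ u v → Connected G (∁ D) u v) →
                                ¬ Disconnecting G D
    connecting⇒¬disconnecting conn (k , k′ , K , K′ , k<k′) =
      <⇒≱ k<k′ (finer⇒≤ (surjective K′) λ u v →
        from (classes K′ u v) ∘ conn ∘ to (classes K u v))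

    -- Removing edges only refines the components, and the component that contains s and t is
    -- properly split.
    separating⇒disconnecting : ∀ {s t} → Connected G ⊤ s t → ¬ Connected G (∁ D) s t →
                               Disconnecting G D
    separating⇒disconnecting {s} {t} s~t s≁t
      with k , K ← components ⊤ | k′ , K′ ← components (∁ D) =
      k , k′ , K , K′ ,
      strictly-finer⇒< (surjective K)
        (λ u v → from (classes K u v) ∘ connected-mono ⊆⊤ ∘ to (classes K′ u v))
        (from (classes K s t) s~t) (s≁t ∘ to (classes K′ s t))

module _ {n m : ℕ} {G : Graph n m} (R : ReferenceOrientation G) where
  open Graph G
  open ReferenceOrientation R
  open Arcs R

  arc-connected : ∀ {S} e δ → e ∈ S → Connected G S (source (e , δ)) (target (e , δ))
  arc-connected e δ e∈S = (e , e∈S , arc⇒joins e δ) ◅ nil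

  connected-stays : ∀ {S X} → (∀ a → proj₁ a ∈ S → source a ∈ X → target a ∈ X) →
                    ∀ {u v} → Connected G S u v → u ∈ X → v ∈ X
  connected-stays closed nil u∈X = u∈X
  connected-stays closed ((e , e∈S , j) ◅ rs) u∈X with joins⇒arc j
  ... | δ , refl , refl = connected-stays closed rs (closed (e , δ) e∈S u∈X)

  -- e separates C, since otherwise C - e would be a smaller disconnecting set;
  -- the side is then the component of the source of e.
  cut⇒exits : ∀ {C} → IsCut G C → ∀ e δ → e ∈ C →
              ∃[ X ] (e , δ) exits X × (∀ f ε → (f , ε) exits X → f ∈ C)
  cut⇒exits {C} (_ , (k , k′ , K , K′ , k<k′) , minimal) e δ e∈C =
    X , (from (∈cluster⇔ G) nil , s≁t ∘ to (∈cluster⇔ G)) , exits⇒∈C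
    where
    s t : Fin n
    s = source (e , δ)
    t = target (e , δ)

    X : Subset n
    X = cluster G (∁ C) s

    exits⇒∈C : ∀ f ε → (f , ε) exits X → f ∈ C
    exits⇒∈C f ε (s∈X , t∉X) = decidable-stable (f ∈? C) λ f∉C →
      t∉X (from (∈cluster⇔ G) (to (∈cluster⇔ G) s∈X ◅◅ arc-connected f ε (x∉p⇒x∈∁p f∉C)))

    module _ (s~t : Connected G (∁ C) s t) where
      open Components

      C-e : Subset m
      C-e = C - e

      conn : ∀ {u v} → Connected G (∁ C-e) u v → Connected G (∁ C) u v
      conn = connected-join G go
        where
        go : ∀ {f u v} → f ∈ ∁ C-e → Joins f u v → Connected G (∁ C) u v
        go {f} f∈ j with f ≟ e
        ... | no f≢e = (f , x∉p⇒x∈∁p (λ f∈C → x∈∁p⇒x∉p f∈ (x∈p∧x≢y⇒x∈p-y f∈C f≢e)) , j) ◅ nil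
        ... | yes refl with joins⇒arc j
        ...   | δ′ , refl , refl with δ≡⊎opposite δ δ′
        ...     | inj₁ refl = s~t
        ...     | inj₂ refl = subst (Connected G (∁ C) t) (sym (target-reverse (e , δ)))
                                    (Connected≈.sym G (∁ C) s~t)

      -- The edge e is bypassed by `s~t`, so putting it back merges no components and the map of
      -- `K′` still describes them.
      disc : Disconnecting G C-e
      disc = k , k′ , K , record
        { component  = component K′
        ; surjective = surjective K′
        ; classes    = λ u v → mk⇔
            (connected-mono G (p⊆q⇒∁p⊇∁q (p─q⊆p C ⁅ e ⁆)) ∘ to (classes K′ u v))
            (from (classes K′ u v) ∘ conn)
        } , k<k′

      -- A nonempty C - e contradicts the minimality of C, and an empty one disconnects nothing.
      absurd : Dec (Nonempty C-e) → Empty.⊥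
      absurd (yes ne) = x∈p─q⇒x∉q (subst (e ∈_) (sym (minimal C-e ne disc (p─q⊆p C ⁅ e ⁆))) e∈C) (x∈⁅x⁆ e)
      absurd (no empty) = connecting⇒¬disconnecting G
        (connected-mono G λ {x} _ → x∉p⇒x∈∁p λ x∈ → empty (x , x∈)) disc

    s≁t : ¬ Connected G (∁ C) s t
    s≁t s~t = absurd s~t (nonempty? (C-e s~t))

  -- Y is the complement of the component of the target of a in G - W, where W
  -- is the component of the source of a in X; so W and ∁ Y are connected.
  exits⇒cut : ∀ X a → a exits X →
              ∃[ Y ] a exits Y × IsCut G (∂ G Y) × (∀ b → b exits Y → b exits X)
  exits⇒cut X a@(e , δ) (s∈X , t∉X) =
    Y , a-exits , ((e , ∈∂⁺ e δ a-exits) , disconnecting , minimal) , exits-Y⇒exits-X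
    where
    side : Subset n → Fin n → Subset n
    side V u = cluster G (∁ (∂ G V)) u

    side-closed : ∀ V u f ε → (f , ε) exits (side V u) → f ∈ ∂ G V
    side-closed V u f ε (s∈ , t∉) = decidable-stable (f ∈? ∂ G V) λ f∉ →
      t∉ (from (∈cluster⇔ G) (to (∈cluster⇔ G) s∈ ◅◅ arc-connected f ε (x∉p⇒x∈∁p f∉)))

    inside⇒inside : ∀ V → ∀ {u v} → Connected G (∁ (∂ G V)) u v → u ∈ V → v ∈ V
    inside⇒inside V = connected-stays λ (f , ε) f∉∂ s∈V →
      decidable-stable (target (f , ε) ∈? V) λ t∉V → x∈∁p⇒x∉p f∉∂ (∈∂⁺ f ε (s∈V , t∉V))

    W Z Y : Subset n
    W = side X (source a)
    Z = side W (target a)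
    Y = ∁ Z

    W⊆X : W ⊆ X
    W⊆X v∈W = inside⇒inside X (to (∈cluster⇔ G) v∈W) s∈X

    t∉W : target a ∉ W
    t∉W = t∉X ∘ W⊆X

    Z⇒∉W : ∀ {v} → v ∈ Z → v ∉ W
    Z⇒∉W v∈Z v∈W = t∉W (inside⇒inside W
      (Connected≈.sym G (∁ (∂ G W)) (to (∈cluster⇔ G) v∈Z)) v∈W)

    -- Z is a component of G - ∂ W, so the edge of b crosses W; its end in Z lies outside W, hence
    -- the other end lies in W.
    exits-Y⇒W : ∀ b → b exits Y → source b ∈ W × target b ∈ Z
    exits-Y⇒W (f , ε) (s∈Y , t∉Y) = decidable-stable (_ ∈? W) ¬s∉W , t∈Z
      where
      t∈Z : target (f , ε) ∈ Z
      t∈Z = x∉∁p⇒x∈p t∉Y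
      s∉Z : source (f , ε) ∉ Z
      s∉Z = x∈∁p⇒x∉p s∈Y
      ¬s∉W : ¬ source (f , ε) ∉ W
      ¬s∉W s∉W with ∈∂⁻ f (side-closed W (target a) f (opposite ε)
                      (t∈Z , subst (_∉ Z) (sym (target-reverse (f , ε))) s∉Z))
      ... | ε′ , s′∈W , _ with δ≡⊎opposite ε ε′
      ...   | inj₁ refl = s∉W s′∈W
      ...   | inj₂ refl = Z⇒∉W t∈Z s′∈W

    exits-Y⇒exits-W : ∀ b → b exits Y → b exits W
    exits-Y⇒exits-W b b-exits with exits-Y⇒W b b-exits
    ... | s∈W , t∈Z = s∈W , Z⇒∉W t∈Z

    exits-Y⇒exits-X : ∀ b → b exits Y → b exits X
    exits-Y⇒exits-X (f , ε) b-exits with exits-Y⇒exits-W (f , ε) b-exits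
    ... | s∈W , t∉W with ∈∂⁻ f (side-closed X (source a) f ε (s∈W , t∉W))
    ...   | ε′ , s′∈X , t′∉X with δ≡⊎opposite ε ε′
    ...     | inj₁ refl = s′∈X , t′∉X
    ...     | inj₂ refl = contradiction (subst (_∈ X) (sym (target-reverse (f , ε))) (W⊆X s∈W)) t′∉X

    ∂-mono : ∀ {V} → (∀ b → b exits Y → b exits V) → ∂ G Y ⊆ ∂ G V
    ∂-mono mono {f} f∈ with ∈∂⁻ f f∈
    ... | ε , b-exits = ∈∂⁺ f ε (mono (f , ε) b-exits)

    a-exits : a exits Y
    a-exits = x∉p⇒x∈∁p (λ s∈Z → Z⇒∉W s∈Z (from (∈cluster⇔ G) nil)) , x∈p⇒x∉∁p (from (∈cluster⇔ G) nil)

    disconnecting : Disconnecting G (∂ G Y)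
    disconnecting = separating⇒disconnecting G (arc-connected e δ ∈⊤) λ s~t →
      proj₂ a-exits (inside⇒inside Y s~t (proj₁ a-exits))

    module _ {D : Subset m} (D⊆∂Y : D ⊆ ∂ G Y) where

      W-connected : ∀ {v} → v ∈ W → Connected G (∁ D) (source a) v
      W-connected v∈W = connected-mono G (p⊆q⇒∁p⊇∁q (∂-mono exits-Y⇒exits-X ∘ D⊆∂Y)) (to (∈cluster⇔ G) v∈W)

      Z-connected : ∀ {v} → v ∈ Z → Connected G (∁ D) (target a) v
      Z-connected v∈Z = connected-mono G (p⊆q⇒∁p⊇∁q (∂-mono exits-Y⇒exits-W ∘ D⊆∂Y)) (to (∈cluster⇔ G) v∈Z)

      -- An edge of ∂ Y spared by D reconnects W with Z. As W and Z stay connected without D, every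
      -- edge of D is then bypassed.
      module _ {f} (f∈ : f ∈ ∂ G Y) (f∉D : f ∉ D) where
        module C≈ = Connected≈ G (∁ D)

        s~t : Connected G (∁ D) (source a) (target a)
        s~t with ∈∂⁻ f f∈
        ... | ε , b-exits with exits-Y⇒W (f , ε) b-exits
        ...   | s∈W , t∈Z = W-connected s∈W ◅◅ arc-connected f ε (x∉p⇒x∈∁p f∉D) ◅◅ C≈.sym (Z-connected t∈Z)

        rejoined : ∀ {g u v} → Joins g u v → Connected G (∁ D) u v
        rejoined {g} j with g ∈? D
        ... | no g∉D = (g , x∉p⇒x∈∁p g∉D , j) ◅ nil
        ... | yes g∈D with ∈∂⁻ g (D⊆∂Y g∈D)
        ...   | ε , b-exits with exits-Y⇒W (g , ε) b-exits
        ...     | s∈W , t∈Z with joins⇒arc j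
        ...       | ε′ , refl , refl with δ≡⊎opposite ε ε′
        ...         | inj₁ refl = C≈.sym (W-connected s∈W) ◅◅ s~t ◅◅ Z-connected t∈Z
        ...         | inj₂ refl = subst (Connected G (∁ D) _) (sym (target-reverse (g , ε)))
                      (C≈.sym (C≈.sym (W-connected s∈W) ◅◅ s~t ◅◅ Z-connected t∈Z))

    minimal : ∀ D → Nonempty D → Disconnecting G D → D ⊆ ∂ G Y → D ≡ ∂ G Y
    minimal D _ disc D⊆∂Y = ⊆-antisym D⊆∂Y λ {f} f∈ → decidable-stable (f ∈? D) λ f∉D →
      connecting⇒¬disconnecting G (connected-join G λ _ → rejoined D⊆∂Y f∈ f∉D) disc

-- Cycles

Unique-map⇒injectiveOn : ∀ {A B : Set} {f : A → B} {xs : List A} → Unique (map f xs) →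
                         ∀ {x y} → x List.∈ xs → y List.∈ xs → f x ≡ f y → x ≡ y
Unique-map⇒injectiveOn _              (here refl) (here refl) _  = refl
Unique-map⇒injectiveOn (fresh ∷ _)    (here refl) (there y∈)  eq =
  contradiction eq (All.lookup fresh (∈-map⁺ _ y∈))
Unique-map⇒injectiveOn (fresh ∷ _)    (there x∈)  (here refl) eq =
  contradiction (sym eq) (All.lookup fresh (∈-map⁺ _ x∈))
Unique-map⇒injectiveOn (_ ∷ distinct) (there x∈)  (there y∈)  eq =
  Unique-map⇒injectiveOn distinct x∈ y∈ eq

module _ {n m : ℕ} {G : Graph n m} (R : ReferenceOrientation G) where
  open Graph G
  open ReferenceOrientation R
  open Arcs R

  Traverses : Arc m → Fin n → Fin n → Set
  Traverses a u v = source a ≡ u × target a ≡ v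

  DirectedWalk : Fin n → List (Fin n × Arc m) → Fin n → Set
  DirectedWalk = Walk proj₁ Traverses

  Step : Pred (Arc m) 0ℓ → Rel (Fin n) 0ℓ
  Step D u v = ∃[ a ] D a × Traverses a u v

  walk-source : ∀ {u ss w} → DirectedWalk u ss w → All (λ (x , b) → source b ≡ x) ss
  walk-source []             = []
  walk-source ((s , _) ∷ ws) = s ∷ walk-source ws

  module _ {P : Pred (Fin n) 0ℓ} where

    walk-start : ∀ {u ss w} → DirectedWalk u ss w → P w → All P (map proj₁ ss) → P u
    walk-start []      Pw _       = Pw
    walk-start (_ ∷ _) _  (p ∷ _) = p

    walk-target : ∀ {u ss w} → DirectedWalk u ss w → P w → All P (map proj₁ ss) →
                  All (P ∘ target ∘ proj₂) ss
    walk-target []                _  _        = []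
    walk-target ((_ , refl) ∷ ws) Pw (_ ∷ ps) = walk-start ws Pw ps ∷ walk-target ws Pw ps

  -- Steps record only their initial vertices, so freshness of the end is a field of its own. The
  -- end becomes the base of the cycle in `arc-cycle`.
  record SimplePath (D : Pred (Arc m) 0ℓ) (u w : Fin n) : Set where
    field
      {steps}           : List (Fin n × Arc m)
      walk              : DirectedWalk u steps w
      end-fresh         : All (w ≢_) (map proj₁ steps)
      vertices-distinct : Unique (map proj₁ steps)
      arcs              : All (D ∘ proj₂) steps

  module _ {D : Pred (Arc m) 0ℓ} where
    open SimplePath

    suffix : ∀ {u w x} (p : SimplePath D u w) → x List.∈ map proj₁ (steps p) → SimplePath D x w
    suffix p@(record { walk = _ ∷ _ }) (here refl) = p
    suffix (record { walk = _ ∷ ws ; end-fresh = _ ∷ fs ; vertices-distinct = _ ∷ us ; arcs = _ ∷ as })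
           (there x∈) =
      suffix (record { walk = ws ; end-fresh = fs ; vertices-distinct = us ; arcs = as }) x∈

    -- If the new start already occurs on the path, the loop at it is cut off by passing to a
    -- `suffix`.
    extend : ∀ {u v w} → Step D u v → SimplePath D v w → SimplePath D u w
    extend {u} {v} {w} (a , Da , t) p with u ≟ w
    ... | yes refl = record { walk = [] ; end-fresh = [] ; vertices-distinct = [] ; arcs = [] }
    ... | no u≢w with DecList._∈?_ _≟_ u (map proj₁ (steps p))
    ...   | yes u∈ = suffix p u∈
    ...   | no  u∉ = record
      { walk              = t ∷ walk p
      ; end-fresh         = (u≢w ∘ sym) ∷ end-fresh p
      ; vertices-distinct = All.¬Any⇒All¬ _ u∉ ∷ vertices-distinct p
      ; arcs              = Da ∷ arcs p
      }

    simplePath : ∀ {u w} → Star (Step D) u w → SimplePath D u w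
    simplePath nil      = record { walk = [] ; end-fresh = [] ; vertices-distinct = [] ; arcs = [] }
    simplePath (s ◅ ss) = extend s (simplePath ss)

  -- A later step along the edge of a would start or end at the source of a.
  walk-edges-distinct : ∀ {u ss w} → DirectedWalk u ss w → All (w ≢_) (map proj₁ ss) →
                   Unique (map proj₁ ss) → Unique (map (proj₁ ∘ proj₂) ss)
  walk-edges-distinct [] _ _ = []
  walk-edges-distinct {u} {w = w} (_∷_ {s = a} (refl , _) ws) (w≢u ∷ w-fresh) (u-fresh ∷ distinct) =
    All.map⁺ (All.tabulate apart) ∷ walk-edges-distinct ws w-fresh distinct
    where
    apart : ∀ {xb} → xb List.∈ _ → proj₁ a ≢ proj₁ (proj₂ xb)
    apart {x , b} xb∈ eq with same-edge {a = a} {b} (sym eq)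
    ... | inj₁ refl = All.lookup u-fresh (∈-map⁺ proj₁ xb∈) (All.lookup (walk-source ws) xb∈)
    ... | inj₂ refl = All.lookup (walk-target ws (w≢u ∘ sym) u-fresh) xb∈ (sym (target-reverse a))

  -- The way back from the target of a is made simple before a closes it; `avoids` keeps the edge of
  -- a off that path.
  arc-cycle : ∀ {D a} → (∀ {b} → D b → proj₁ a ≢ proj₁ b) → Star (Step D) (target a) (source a) →
              Σ[ Cy ∈ DirectedCycle R ] a List.∈ SimpleCycle.trace Cy
                × (∀ {b} → b List.∈ SimpleCycle.trace Cy → b ≡ a ⊎ D b)
  arc-cycle {D} {a} avoids path = cycle , here refl , arcs′
    where
    p = simplePath {D} path
    open SimplePath p
    cycle : DirectedCycle R
    cycle = record
      { base              = source a
      ; steps             = (source a , a) ∷ steps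
      ; walk              = (refl , refl) ∷ walk
      ; nonempty          = λ ()
      ; vertices-distinct = end-fresh ∷ vertices-distinct
      ; edges-distinct    = All.map⁺ (All.map avoids arcs) ∷ walk-edges-distinct walk end-fresh vertices-distinct
      }
    arcs′ : ∀ {b} → b List.∈ SimpleCycle.trace cycle → b ≡ a ⊎ D b
    arcs′ (here refl) = inj₁ refl
    arcs′ (there b∈) with ∈-map⁻ proj₂ b∈
    ... | _ , xb∈ , refl = inj₂ (All.lookup arcs xb∈)

  module _ {X : Subset n} where

    walk-closed : ∀ {u ss w} → DirectedWalk u ss w →
                  (∀ {b} → b List.∈ map proj₂ ss → target b ∈ X → source b ∈ X) → w ∈ X → u ∈ X
    walk-closed [] closed w∈X = w∈X
    walk-closed ((refl , refl) ∷ ws) closed w∈X =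
      closed (here refl) (walk-closed ws (closed ∘ there) w∈X)

    through : ∀ {u ss w a} → DirectedWalk u ss w →
              (∀ {b} → b List.∈ map proj₂ ss → target b ∈ X → source b ∈ X) →
              a List.∈ map proj₂ ss → (source a ∈ X → u ∈ X) × (w ∈ X → target a ∈ X)
    through ((refl , refl) ∷ ws) closed (here refl) = id , walk-closed ws (closed ∘ there)
    through ((refl , refl) ∷ ws) closed (there a∈) with through ws (closed ∘ there) a∈
    ... | s , t = closed (here refl) ∘ s , t

    -- A cycle that leaves X has to return. If no arc enters X, membership propagates backwards from
    -- the source of a all the way around to its target.
    cycle-exits-⊥ : ∀ (Cy : DirectedCycle R) {a} → a List.∈ SimpleCycle.trace Cy → a exits X →
                    ¬ (∀ {b} → b List.∈ SimpleCycle.trace Cy → proj₁ b ≢ proj₁ a →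
                       target b ∈ X → source b ∈ X)
    cycle-exits-⊥ Cy {a} a∈ (s∈X , t∉X) closed with through walk closed′ a∈
      where
      open SimpleCycle Cy
      closed′ : ∀ {b} → b List.∈ trace → target b ∈ X → source b ∈ X
      closed′ {b} b∈ with proj₁ b ≟ proj₁ a
      ... | no neq = closed b∈ neq
      -- The edges of a cycle are distinct, so an arc on the edge of a is a itself, whose target
      -- lies outside X.
      ... | yes eq with Unique-map⇒injectiveOn {f = proj₁} (subst Unique (map-∘ steps) edges-distinct) b∈ a∈ eq
      ...   | refl = λ t∈X → contradiction t∈X t∉X
    ... | s , t = t∉X (t (s s∈X))

  UndirectedCycle : Set
  UndirectedCycle = SimpleCycle id Joins

  forget : Fin n × Arc m → Fin n × Fin m
  forget (x , b) = x , proj₁ b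

  forget-walk : ∀ {u ss w} → DirectedWalk u ss w → Walk id Joins u (map forget ss) w
  forget-walk [] = []
  forget-walk (_∷_ {s = e , δ} (refl , refl) ws) = arc⇒joins e δ ∷ forget-walk ws

  orient-walk : ∀ {u ss w} → Walk id Joins u ss w → ∃[ ts ] DirectedWalk u ts w × map forget ts ≡ ss
  orient-walk [] = [] , [] , refl
  orient-walk (_∷_ {s = e} j ws) with joins⇒arc j | orient-walk ws
  ... | δ , t | ts , ws′ , refl = (_ , e , δ) ∷ ts , t ∷ ws′ , refl

  forget-cycle : (Cy : DirectedCycle R) → Σ[ c ∈ UndirectedCycle ] SimpleCycle.edges c ≡ SimpleCycle.edges Cy
  forget-cycle Cy = record
    { base              = base
    ; steps             = map forget steps
    ; walk              = forget-walk walk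
    ; nonempty          = λ eq → nonempty (empty eq)
    ; vertices-distinct = subst Unique (map-∘ steps) vertices-distinct
    ; edges-distinct    = subst Unique (map-∘ steps) (SimpleCycle.edges-distinct Cy)
    } , trans (sym (map-∘ _)) (trans (sym (map-∘ steps)) (map-∘ steps))
    where
    open SimpleCycle Cy
    empty : ∀ {ss} → map forget ss ≡ [] → ss ≡ []
    empty {[]} _ = refl

  orient-cycle : (c : UndirectedCycle) → Σ[ Cy ∈ DirectedCycle R ] SimpleCycle.edges Cy ≡ SimpleCycle.edges c
  orient-cycle record { walk = walk ; nonempty = nonempty ; vertices-distinct = v-distinct ; edges-distinct = e-distinct }
    with orient-walk walk
  ... | ts , walk′ , refl = record
    { walk              = walk′
    ; nonempty          = λ { refl → nonempty refl }
    ; vertices-distinct = subst Unique (sym (map-∘ ts)) v-distinct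
    ; edges-distinct    = subst Unique (sym (map-∘ ts)) e-distinct
    } , trans (sym (map-∘ ts)) (trans (map-∘ ts) (map-∘ _))

-- Separation of an arc from the barrier of its competitors

module _ {m : ℕ} {D : Pred (Arc m) 0ℓ} (D? : Decidable D) where

  anyArc? : Dec (∃[ a ] D a)
  anyArc? = map′ [ (λ (e , p) → (e , Sign.+) , p) , (λ (e , p) → (e , Sign.-) , p) ]′
                 (λ { ((e , Sign.+) , p) → inj₁ (e , p) ; ((e , Sign.-) , p) → inj₂ (e , p) })
                 (any? (λ e → D? (e , Sign.+)) ⊎-dec any? (λ e → D? (e , Sign.-)))

  allArcs? : Dec (∀ a → D a)
  allArcs? = map′ (λ (p , q) → λ { (e , Sign.+) → p e ; (e , Sign.-) → q e })
                  (λ p → (λ e → p (e , Sign.+)) , (λ e → p (e , Sign.-)))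
                  (all? (λ e → D? (e , Sign.+)) ×-dec all? (λ e → D? (e , Sign.-)))

module _ {n m : ℕ} {G : Graph n m} (R : ReferenceOrientation G) where
  open ReferenceOrientation R
  open Arcs R

  Closed : Pred (Arc m) 0ℓ → Subset n → Set
  Closed D X = ∀ b → D b → target b ∈ X → source b ∈ X

  -- Dual to reachability: for decidable D, separation fails exactly when D contains a directed path
  -- from the target of a back to its source. This lets one notion serve both cuts and cycles.
  record Sep (D : Pred (Arc m) 0ℓ) (a : Arc m) : Set where
    constructor sep
    field
      side    : Subset n
      crosses : a exits side
      closed  : Closed D side

  Sep-antitone : ∀ {D D′ a} → (∀ b → D′ b → D b) → Sep D a → Sep D′ a
  Sep-antitone D′⊆D (sep X a-exits closed) = sep X a-exits λ b → closed b ∘ D′⊆D b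

  abstract
    Sep? : ∀ {D} → Decidable D → ∀ a → Dec (Sep D a)
    Sep? D? a = map′ (λ (X , a-exits , closed) → sep X a-exits closed)
                     (λ (sep X a-exits closed) → X , a-exits , closed)
      (anySubset? λ X →
        (source a ∈? X ×-dec ¬? (target a ∈? X)) ×-dec
        allArcs? λ b → D? b →-dec (target b ∈? X →-dec source b ∈? X))

  closed⇒¬enters : ∀ {D X} → Closed D X → ∀ b → D (reverse b) → ¬ b exits X
  closed⇒¬enters {X = X} closed b Db (s∈X , t∉X) =
    t∉X (closed (reverse b) Db (subst (_∈ X) (sym (target-reverse b)) s∈X))

  ¬enters⇒closed : ∀ {D X} → (∀ b → D b → ¬ (reverse b) exits X) → Closed D X
  ¬enters⇒closed {X = X} ¬enters b Db t∈X = decidable-stable (source b ∈? X) λ s∉X →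
    ¬enters b Db (t∈X , subst (_∉ X) (sym (target-reverse b)) s∉X)

  -- If D is closed under reversal, no arc of D leaves the side either, so the complement is a side
  -- for the reversed arc.
  Sep-reverse : ∀ {D a} → (∀ b → D b → D (reverse b)) → Sep D a → Sep D (reverse a)
  Sep-reverse {a = a} symm (sep X (s∈X , t∉X) closed) =
    sep (∁ X) (x∉p⇒x∈∁p t∉X , x∈p⇒x∉∁p (subst (_∈ X) (sym (target-reverse a)) s∈X))
    λ b Db t∈∁X → x∉p⇒x∈∁p λ s∈X → x∈∁p⇒x∉p t∈∁X
      (closed (reverse b) (symm b Db) (subst (_∈ X) (sym (target-reverse b)) s∈X))

  Sep-anyDirection : ∀ {D e} → (∀ b → D b → D (reverse b)) → ∀ δ δ′ → Sep D (e , δ) → Sep D (e , δ′)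
  Sep-anyDirection symm δ δ′ separated with δ≡⊎opposite δ δ′
  ... | inj₁ refl = separated
  ... | inj₂ refl = Sep-reverse symm separated

  -- The complement of the set F reachable from the target of a is entered by no arc of D, so it
  -- would separate a if F missed the source.
  ¬Sep⇒path : ∀ {D} → Decidable D → ∀ a → ¬ Sep D a → Star (Step R D) (target a) (source a)
  ¬Sep⇒path {D} D? a ¬sep
    with reachable {R = Step R D}
           (λ u v → anyArc? λ b → D? b ×-dec (source b ≟ u ×-dec target b ≟ v)) (target a)
  ... | F , reach = to (reach _) (decidable-stable (source a ∈? F) λ s∉F →
    ¬sep (sep (∁ F) (x∉p⇒x∈∁p s∉F , x∈p⇒x∉∁p (from (reach _) nil))
          λ b Db t∈∁F → x∉p⇒x∈∁p λ s∈F → x∈∁p⇒x∉p t∈∁F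
            (from (reach _) (to (reach _) s∈F ◅◅ (b , Db , refl , refl) ◅ nil))))

≺⇒≢ : ∀ {m} {_≺_ : Rel (Fin m) 0ℓ} → IsStrictTotalOrder _≡_ _≺_ → ∀ {e f} → e ≺ f → e ≢ f
≺⇒≢ sto e≺f e≡f = IsStrictTotalOrder.irrefl sto e≡f e≺f

_∈ᶠ?_ : ∀ {m} (a : Arc m) O → Dec (a ∈ᶠ O)
(e , Sign.+) ∈ᶠ? O = e ∈? pos O
(e , Sign.-) ∈ᶠ? O = e ∈? neg O

module _ {n m : ℕ} {G : Graph n m} (R : ReferenceOrientation G)
         {_≺_ : Rel (Fin m) 0ℓ} (sto : IsStrictTotalOrder _≡_ _≺_) where
  open ReferenceOrientation R
  open Arcs R
  open IsStrictTotalOrder sto using (_<?_; asym; compare)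

  -- The barrier contains both arcs of each of its edges, so none of these edges crosses a closed
  -- side at all. `cut⇒exits` and `exits⇒cut` translate between such sides and cuts.
  Î⇔Sep : ∀ S e δ → Î G _≺_ S e ⇔
          Sep R (λ b → proj₁ b ≺ e ⊎ e ≺ proj₁ b × proj₁ b ∈ S) (e , δ)
  Î⇔Sep S e δ = mk⇔ cut⇒sep sep⇒cut
    where
    D : Pred (Arc m) 0ℓ
    D b = proj₁ b ≺ e ⊎ e ≺ proj₁ b × proj₁ b ∈ S

    cut⇒sep : Î G _≺_ S e → Sep R D (e , δ)
    cut⇒sep (C , cut , disjoint , e∈C , least) with cut⇒exits R cut e δ e∈C
    ... | X , e-exits , exits⇒∈C = sep X e-exits (¬enters⇒closed R ¬enters)
      where
      ¬enters : ∀ b → D b → ¬ (reverse b) exits X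
      ¬enters (f , γ) (inj₁ f≺e) f-exits =
        asym f≺e (least (exits⇒∈C f (opposite γ) f-exits) (≺⇒≢ sto f≺e))
      ¬enters (f , γ) (inj₂ (e≺f , f∈S)) f-exits =
        disjoint (f , x∈p∩q⁺ (exits⇒∈C f (opposite γ) f-exits , x∈p∧x≢y⇒x∈p-y f∈S (≺⇒≢ sto e≺f ∘ sym)))

    sep⇒cut : Sep R D (e , δ) → Î G _≺_ S e
    sep⇒cut (sep X e-exits closed) with exits⇒cut R X (e , δ) e-exits
    ... | Y , e-exits-Y , cut , Y⇒X = ∂ G Y , cut , disjoint , ∈∂⁺ e δ e-exits-Y , least
      where
      ¬D : ∀ {f} → f ∈ ∂ G Y → ¬ (f ≺ e ⊎ e ≺ f × f ∈ S)
      ¬D {f} f∈ Df with ∈∂⁻ f f∈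
      ... | γ , f-exits = closed⇒¬enters R closed (f , γ) Df (Y⇒X (f , γ) f-exits)
      least : ∀ {f} → f ∈ ∂ G Y → f ≢ e → e ≺ f
      least {f} f∈ f≢e with compare e f
      ... | B.tri< e≺f _ _ = e≺f
      ... | B.tri≈ _ e≡f _ = contradiction (sym e≡f) f≢e
      ... | B.tri> _ _ f≺e = contradiction (inj₁ f≺e) (¬D f∈)
      disjoint : Empty (∂ G Y ∩ (S - e))
      disjoint (f , f∈) with x∈p∩q⁻ (∂ G Y) (S - e) f∈
      ... | f∈∂Y , f∈S-e = ¬D f∈∂Y (inj₂ (least f∈∂Y f≢e , p─q⊆p S ⁅ e ⁆ f∈S-e))
        where
        f≢e : f ≢ e
        f≢e refl = x∈p─q⇒x∉q f∈S-e (x∈⁅x⁆ e)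

  -- Since (e , δ) lies in O, a potential cut can be crossed by e only in direction δ; closure of
  -- the side under the arcs of O is what makes the cut potential.
  MinOfPotentialCut⇔Sep : ∀ O {e} δ → ¬ ((e , opposite δ) ∈ᶠ O) → (e , δ) ∈ᶠ O →
    MinOfPotentialCut R _≺_ O e ⇔ Sep R (λ b → proj₁ b ≺ e ⊎ b ∈ᶠ O) (e , δ)
  MinOfPotentialCut⇔Sep O {e} δ e⁻∉O e⁺∈O = mk⇔ cut⇒sep sep⇒cut
    where
    D : Pred (Arc m) 0ℓ
    D b = proj₁ b ≺ e ⊎ b ∈ᶠ O

    cut⇒sep : MinOfPotentialCut R _≺_ O e → Sep R D (e , δ)
    cut⇒sep (Cu , potential , e∈∂ , least) with ∈∂⁻ e e∈∂
    ... | δ′ , e-exits with δ≡⊎opposite δ δ′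
    ...   | inj₂ refl = contradiction (subst (λ δ → (e , δ) ∈ᶠ O) (sym (opposite-involutive δ)) e⁺∈O)
                                      (potential e δ′ e-exits)
    ...   | inj₁ refl = sep side e-exits (¬enters⇒closed R ¬enters)
      where
      open DirectedCut Cu
      ¬enters : ∀ b → D b → ¬ (reverse b) exits side
      ¬enters (f , γ) (inj₁ f≺e) f-exits = asym f≺e (least (∈∂⁺ f (opposite γ) f-exits) (≺⇒≢ sto f≺e))
      ¬enters (f , γ) (inj₂ f∈O) f-exits = potential f (opposite γ) f-exits
        (subst (λ γ → (f , γ) ∈ᶠ O) (sym (opposite-involutive γ)) f∈O)

    sep⇒cut : Sep R D (e , δ) → MinOfPotentialCut R _≺_ O e
    sep⇒cut (sep X e-exits closed) with exits⇒cut R X (e , δ) e-exits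
    ... | Y , e-exits-Y , cut , Y⇒X =
      record { side = Y ; isCut = cut } ,
      (λ f γ f-exits f∈O → closed⇒¬enters R closed (f , γ) (inj₂ f∈O) (Y⇒X (f , γ) f-exits)) ,
      ∈∂⁺ e δ e-exits-Y , least
      where
      least : ∀ {f} → f ∈ ∂ G Y → f ≢ e → e ≺ f
      least {f} f∈ f≢e with compare e f | ∈∂⁻ f f∈
      ... | B.tri< e≺f _ _ | _ = e≺f
      ... | B.tri≈ _ e≡f _ | _ = contradiction (sym e≡f) f≢e
      ... | B.tri> _ _ f≺e | γ , f-exits =
        contradiction (Y⇒X (f , γ) f-exits) (closed⇒¬enters R closed (f , γ) (inj₁ f≺e))

  -- A potential cycle can use e only along (e , δ), and its remaining arcs form the way back to the
  -- source. So the question is whether D offers such a way, which is dual to separation.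
  MinOfPotentialCycle⇔¬Sep : ∀ O {e} δ → ¬ ((e , opposite δ) ∈ᶠ O) → (e , δ) ∈ᶠ O →
    MinOfPotentialCycle R _≺_ O e ⇔ (¬ Sep R (λ b → e ≺ proj₁ b × b ∈ᶠ O) (e , δ))
  MinOfPotentialCycle⇔¬Sep O {e} δ e⁻∉O e⁺∈O = mk⇔ cycle⇒¬sep ¬sep⇒cycle
    where
    D : Pred (Arc m) 0ℓ
    D b = e ≺ proj₁ b × b ∈ᶠ O

    cycle⇒¬sep : MinOfPotentialCycle R _≺_ O e → ¬ Sep R D (e , δ)
    cycle⇒¬sep (Cy , potential , e∈Cy , least) (sep X e-exits closed) with ∈-map⁻ proj₁ e∈Cy
    ... | (_ , δ′) , a∈ , refl with δ≡⊎opposite δ δ′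
    ...   | inj₂ refl = e⁻∉O (potential e δ′ a∈)
    ...   | inj₁ refl = cycle-exits-⊥ R {X} Cy a∈ e-exits λ {b} b∈ b≢e →
      closed b (least (∈-map⁺ proj₁ b∈) b≢e , potential (proj₁ b) (proj₂ b) b∈)

    ¬sep⇒cycle : ¬ Sep R D (e , δ) → MinOfPotentialCycle R _≺_ O e
    ¬sep⇒cycle ¬sep with arc-cycle R {D} {e , δ} (≺⇒≢ sto ∘ proj₁)
                           (¬Sep⇒path R (λ b → e <? proj₁ b ×-dec b ∈ᶠ? O) (e , δ) ¬sep)
    ... | Cy , a∈ , arcs = Cy , potential , ∈-map⁺ proj₁ a∈ , least
      where
      potential : PotentialCycle R O Cy
      potential f γ b∈ with arcs b∈
      ... | inj₁ refl      = e⁺∈O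
      ... | inj₂ (_ , f∈O) = f∈O
      least : ∀ {f} → f List.∈ SimpleCycle.edges Cy → f ≢ e → e ≺ f
      least f∈ f≢e with ∈-map⁻ proj₁ f∈
      ... | b , b∈ , refl with arcs b∈
      ...   | inj₁ refl      = contradiction refl f≢e
      ...   | inj₂ (e≺f , _) = e≺f

  L̂⇔¬Sep : ∀ S e δ → L̂ G _≺_ S e ⇔ (¬ Sep R (λ b → e ≺ proj₁ b × proj₁ b ∈ S) (e , δ))
  L̂⇔¬Sep S e δ = mk⇔ cycle⇒¬sep ¬sep⇒cycle
    where
    D : Pred (Arc m) 0ℓ
    D b = e ≺ proj₁ b × proj₁ b ∈ S

    cycle⇒¬sep : L̂ G _≺_ S e → ¬ Sep R D (e , δ)
    cycle⇒¬sep (C , (c , ∈C⇔) , C⊆ , e∈C , least) separated with orient-cycle R c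
    ... | Cy , edges≡ with ∈-map⁻ proj₁ (subst (e List.∈_) (sym edges≡) (to (∈C⇔ e) e∈C))
    -- The orientation obtained for the cycle may traverse e against δ; as D is symmetric, the
    -- separation can be turned around to match.
    ...   | (_ , δ′) , a∈ , refl with Sep-anyDirection R (λ _ Db → Db) δ δ′ separated
    ...     | sep X e-exits closed = cycle-exits-⊥ R {X} Cy a∈ e-exits λ {b} b∈ b≢e →
      let b∈C = from (∈C⇔ _) (subst (proj₁ b List.∈_) edges≡ (∈-map⁺ proj₁ b∈)) in
      closed b (least b∈C b≢e ,
                [ id , (λ b∈e → contradiction (x∈⁅y⁆⇒x≡y e b∈e) b≢e) ]′ (x∈p∪q⁻ S ⁅ e ⁆ (C⊆ b∈C)))

    ¬sep⇒cycle : ¬ Sep R D (e , δ) → L̂ G _≺_ S e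
    ¬sep⇒cycle ¬sep with arc-cycle R {D} {e , δ} (≺⇒≢ sto ∘ proj₁)
                           (¬Sep⇒path R (λ b → e <? proj₁ b ×-dec proj₁ b ∈? S) (e , δ) ¬sep)
    ... | Cy , a∈ , arcs with forget-cycle R Cy
    ...   | c , edges≡ =
      C , (c , λ f → mk⇔ (∈-select⁻ ∈c?) (∈-select⁺ ∈c?)) , C⊆ ,
      ∈-select⁺ ∈c? (subst (e List.∈_) (sym edges≡) (∈-map⁺ proj₁ a∈)) , least
      where
      ∈c? : Decidable (List._∈ SimpleCycle.edges c)
      ∈c? f = DecList._∈?_ _≟_ f (SimpleCycle.edges c)
      C : Subset m
      C = select ∈c?
      e⊎D : ∀ {f} → f ∈ C → f ≡ e ⊎ e ≺ f × f ∈ S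
      e⊎D {f} f∈C with ∈-map⁻ proj₁ (subst (f List.∈_) edges≡ (∈-select⁻ ∈c? f∈C))
      ... | b , b∈ , refl = [ (λ { refl → inj₁ refl }) , inj₂ ]′ (arcs b∈)
      C⊆ : C ⊆ S ∪ ⁅ e ⁆
      C⊆ f∈C with e⊎D f∈C
      ... | inj₁ refl      = q⊆p∪q S ⁅ e ⁆ (x∈⁅x⁆ e)
      ... | inj₂ (_ , f∈S) = p⊆p∪q ⁅ e ⁆ f∈S
      least : ∀ {f} → f ∈ C → f ≢ e → e ≺ f
      least f∈C f≢e = [ (λ eq → contradiction eq f≢e) , proj₁ ]′ (e⊎D f∈C)

-- Deletions and contractions

-- Deleting an edge amounts to unorienting it, contracting it to biorienting it.
data Status : Set where
  un bi : Status
  one   : Sign → Status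

Has : Status → Sign → Set
Has un      δ = Empty.⊥
Has bi      δ = Unit.⊤
Has (one ε) δ = δ ≡ ε

has? : ∀ s δ → Dec (Has s δ)
has? un      δ = no λ ()
has? bi      δ = yes _
has? (one ε) δ = δ Sign.≟ ε

Config : ℕ → Set
Config m = Fin m → Status

module _ {m : ℕ} where

  arcs : Config m → Pred (Arc m) 0ℓ
  arcs C (h , γ) = Has (C h) γ

  infixl 5 _[_≔_]
  _[_≔_] : Pred (Arc m) 0ℓ → Fin m → Status → Pred (Arc m) 0ℓ
  (D [ e ≔ s ]) b = proj₁ b ≢ e × D b ⊎ proj₁ b ≡ e × Has s (proj₂ b)

  ≔? : ∀ {D} → Decidable D → ∀ e s → Decidable (D [ e ≔ s ])
  ≔? D? e s b = (¬? (proj₁ b ≟ e) ×-dec D? b) ⊎-dec (proj₁ b ≟ e ×-dec has? s (proj₂ b))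

module _ {n m : ℕ} {G : Graph n m} (R : ReferenceOrientation G) where
  open ReferenceOrientation R
  open Arcs R

  module _ {D : Pred (Arc m) 0ℓ} {e : Fin m} where

    ≔-closed : ∀ {s X} → (∀ b → proj₁ b ≢ e → D b → target b ∈ X → source b ∈ X) →
               (∀ γ → Has s γ → target (e , γ) ∈ X → source (e , γ) ∈ X) →
               Closed R (D [ e ≔ s ]) X
    ≔-closed off at b       (inj₁ (b≢e , Db))   = off b b≢e Db
    ≔-closed off at (_ , γ) (inj₂ (refl , has)) = at γ has

    closed-off : ∀ {s X} → Closed R (D [ e ≔ s ]) X →
                 ∀ b → proj₁ b ≢ e → D b → target b ∈ X → source b ∈ X
    closed-off closed b b≢e Db = closed b (inj₁ (b≢e , Db))

    closed-at : ∀ {s X} → Closed R (D [ e ≔ s ]) X →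
                ∀ γ → Has s γ → target (e , γ) ∈ X → source (e , γ) ∈ X
    closed-at closed γ has = closed (e , γ) (inj₂ (refl , has))

    Sep-bi⇒ : ∀ {s a} → Sep R (D [ e ≔ bi ]) a → Sep R (D [ e ≔ s ]) a
    Sep-bi⇒ = Sep-antitone R λ { _ (inj₁ p) → inj₁ p ; _ (inj₂ (p , _)) → inj₂ (p , _) }

    Sep⇒un : ∀ {s a} → Sep R (D [ e ≔ s ]) a → Sep R (D [ e ≔ un ]) a
    Sep⇒un = Sep-antitone R λ { _ (inj₁ p) → inj₁ p }

    -- No side is entered by both arcs of e, so a side found with e deleted survives the insertion
    -- of one of them.
    Sep-split : ∀ {a} ε → Sep R (D [ e ≔ un ]) a →
                Sep R (D [ e ≔ one ε ]) a ⊎ Sep R (D [ e ≔ one (opposite ε) ]) a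
    Sep-split ε (sep X a-exits closed) with (target (e , ε) ∈? X) →-dec (source (e , ε) ∈? X)
    ... | yes ok = inj₁ (sep X a-exits (≔-closed (closed-off closed) λ { _ refl → ok }))
    ... | no ¬ok = inj₂ (sep X a-exits (≔-closed (closed-off closed) λ { _ refl s∈X →
      contradiction (λ _ → subst (_∈ X) (target-reverse (e , ε)) s∈X) ¬ok }))

    ≔bi-closed : ∀ ε {X} → Closed R (D [ e ≔ one ε ]) X → ¬ (e , ε) exits X →
                 Closed R (D [ e ≔ bi ]) X
    ≔bi-closed ε {X} closed ¬exits = ≔-closed (closed-off closed) at
      where
      at : ∀ γ → Unit.⊤ → target (e , γ) ∈ X → source (e , γ) ∈ X
      at γ _ with δ≡⊎opposite ε γ
      ... | inj₁ refl = closed-at closed γ refl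
      ... | inj₂ refl = λ s∈X → decidable-stable (_ ∈? X) λ t∉X →
        ¬exits (subst (_∈ X) (target-reverse (e , ε)) s∈X , t∉X)

    -- A side that e^ε does not enter is either left by e^ε or not crossed by e at all. In the
    -- second case it would still separate a with e contracted.
    exits-pivot : ∀ {a} ε → Sep R (D [ e ≔ one ε ]) a → ¬ Sep R (D [ e ≔ bi ]) a →
                  ∃[ X ] a exits X × (e , ε) exits X × Closed R (D [ e ≔ one ε ]) X
    exits-pivot ε (sep X a-exits closed) ¬sep =
      X , a-exits ,
      decidable-stable (source (e , ε) ∈? X ×-dec ¬? (target (e , ε) ∈? X))
        (λ ¬exits → ¬sep (sep X a-exits (≔bi-closed ε closed ¬exits))) ,
      closed

  -- e^ε exits X and e^-ε exits Y, so e crosses neither X ∩ Y nor X ∪ Y; and a,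
  -- which exits X and does not enter Y, exits one of the two.
  crossing : ∀ {D D′ : Pred (Arc m) 0ℓ} {e a a′} ε → proj₁ a ≢ e →
             (∀ b → proj₁ b ≢ e → D b → D′ b) → D′ a →
             Sep R (D [ e ≔ one ε ]) a → Sep R (D′ [ e ≔ one (opposite ε) ]) a′ →
             ¬ Sep R (D [ e ≔ bi ]) a → ¬ ¬ Sep R (D′ [ e ≔ bi ]) a′
  crossing {D} {D′} {e} {a} ε a≢e D⊆D′ D′a sepX sepY ¬bi ¬bi′
    with exits-pivot ε sepX ¬bi | exits-pivot (opposite ε) sepY ¬bi′
  ... | X , (s∈X , t∉X) , (eˢ∈X , eᵗ∉X) , closedX | Y , _ , (eᵗ∈Y , eˢ∉Y′) , closedY
    with target a ∈? Y
  -- The arc a lies in D′, so its source is in Y along with its target. Since D is contained in D′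
  -- away from e, Y is closed under those arcs of D as well.
  ... | yes t∈Y = ¬bi (sep (X ∩ Y) (x∈p∩q⁺ (s∈X , closed-off closedY a a≢e D′a t∈Y) , t∉X ∘ p∩q⊆p X Y)
                       (≔-closed off (λ γ _ → contradiction′ γ)))
    where
    off : ∀ b → proj₁ b ≢ e → D b → target b ∈ X ∩ Y → source b ∈ X ∩ Y
    off b b≢e Db t∈ with x∈p∩q⁻ X Y t∈
    ... | t∈X , t∈Y = x∈p∩q⁺ (closed-off closedX b b≢e Db t∈X , closed-off closedY b b≢e (D⊆D′ b b≢e Db) t∈Y)
    contradiction′ : ∀ γ → target (e , γ) ∈ X ∩ Y → source (e , γ) ∈ X ∩ Y
    contradiction′ γ t∈ with δ≡⊎opposite ε γ
    ... | inj₁ refl = contradiction (p∩q⊆p X Y t∈) eᵗ∉X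
    ... | inj₂ refl = contradiction (p∩q⊆q X Y t∈) eˢ∉Y′
  ... | no t∉Y = ¬bi (sep (X ∪ Y) (p⊆p∪q Y s∈X , [ t∉X , t∉Y ]′ ∘ x∈p∪q⁻ X Y)
                      (≔-closed off (λ γ _ _ → both γ)))
    where
    off : ∀ b → proj₁ b ≢ e → D b → target b ∈ X ∪ Y → source b ∈ X ∪ Y
    off b b≢e Db t∈ with x∈p∪q⁻ X Y t∈
    ... | inj₁ t∈X = p⊆p∪q Y (closed-off closedX b b≢e Db t∈X)
    ... | inj₂ t∈Y = q⊆p∪q X Y (closed-off closedY b b≢e (D⊆D′ b b≢e Db) t∈Y)
    both : ∀ γ → source (e , γ) ∈ X ∪ Y
    both γ with δ≡⊎opposite ε γ
    ... | inj₁ refl = p⊆p∪q Y eˢ∈X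
    ... | inj₂ refl = q⊆p∪q X Y eᵗ∈Y

-- The choice made for a single edge

-- The result `true` stands for contraction, that is, for membership in φ(O). The bit c is the fate
-- of e⁺, and e⁻ receives the other one.
settle : Bool → Status → Bool
settle c un            = false
settle c bi            = true
settle c (one Sign.+)  = c
settle c (one Sign.-)  = not c

settled : Bool → Status
settled false = un
settled true  = bi

has-settled : ∀ {b γ} → Has (settled b) γ → b ≡ true
has-settled {true} _ = refl

data Kind : Set where
  cut cycle : Kind

module Activities {n m : ℕ} {G : Graph n m} (R : ReferenceOrientation G)
         {_≺_ : Rel (Fin m) 0ℓ} (sto : IsStrictTotalOrder _≡_ _≺_)
         (σᵘ σᵇ : Fin m → Sign) where
  open IsStrictTotalOrder sto using (_<?_; irrefl; asym; compare) renaming (trans to ≺-trans)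

  -- The direction in which f is traversed when its activity is tested; an
  -- unoriented or bioriented f is first made oriented by means of σᵘ or σᵇ.
  direction : Fin m → Status → Sign
  direction f un      = σᵘ f
  direction f bi      = opposite (σᵇ f)
  direction f (one δ) = δ

  own : Config m → Fin m → Arc m
  own C f = f , direction f (C f)

  directed : Config m → Fin m → Pred (Arc m) 0ℓ
  directed C f = arcs C [ f ≔ one (direction f (C f)) ]

  -- f is cut active iff its own arc is separated by Barrier cut, and cycle
  -- active iff its own arc is not separated by Barrier cycle.
  Barrier : Kind → Config m → Fin m → Pred (Arc m) 0ℓ
  Barrier cut   C f b = proj₁ b ≺ f ⊎ directed C f b
  Barrier cycle C f b = ¬ (proj₁ b ≺ f) × directed C f b

  -- Nothing is claimed about cut activity of bioriented edges or cycle activity of unoriented ones.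
  -- For the remaining edges the barriers are nested.
  Admissible : Kind → Status → Set
  Admissible cut   s = s ≢ bi
  Admissible cycle s = s ≢ un

  barrier? : ∀ K C f → Decidable (Barrier K C f)
  barrier? K C f with K | ≔? {D = arcs C} (λ b → has? (C (proj₁ b)) (proj₂ b)) f (one (direction f (C f)))
  ... | cut   | d? = λ b → proj₁ b <? f ⊎-dec d? b
  ... | cycle | d? = λ b → ¬? (proj₁ b <? f) ×-dec d? b

  admissible? : ∀ K s → Dec (Admissible K s)
  admissible? cut   un      = yes λ ()
  admissible? cut   bi      = no λ ¬p → ¬p refl
  admissible? cut   (one _) = yes λ ()
  admissible? cycle un      = no λ ¬p → ¬p refl
  admissible? cycle bi      = yes λ ()
  admissible? cycle (one _) = yes λ ()

  -- Giving f a single direction adds an arc if f was unoriented and drops one if it was bioriented.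
  -- The inclusions here and in `arc⇒directed` each exclude one of these cases.
  directed⇒arc : ∀ {C f} → C f ≢ un → ∀ b → directed C f b → arcs C b
  directed⇒arc         _    b (inj₁ (_ , Cb)) = Cb
  directed⇒arc {C} {f} ¬un (_ , γ) (inj₂ (refl , γ≡)) with C f
  ... | un    = contradiction refl ¬un
  ... | bi    = _
  ... | one _ = γ≡

  arc⇒directed : ∀ {C f} → C f ≢ bi → ∀ b → arcs C b → directed C f b
  arc⇒directed {C} {f} ¬bi (h , γ) Cb with h ≟ f
  ... | no h≢f = inj₁ (h≢f , Cb)
  ... | yes refl with C f
  ...   | bi    = contradiction refl ¬bi
  ...   | one _ = inj₂ (refl , Cb)

  directed⇒barrier : ∀ K {C f b} → ¬ (proj₁ b ≺ f) → directed C f b → Barrier K C f b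
  directed⇒barrier cut   b⊀f d = inj₂ d
  directed⇒barrier cycle b⊀f d = b⊀f , d

  barrier⇒directed : ∀ K {C f b} → ¬ (proj₁ b ≺ f) → Barrier K C f b → directed C f b
  barrier⇒directed cut   b⊀f (inj₁ b≺f) = contradiction b≺f b⊀f
  barrier⇒directed cut   b⊀f (inj₂ d)   = d
  barrier⇒directed cycle b⊀f (_ , d)    = d

  own∈Barrier : ∀ K C f → Barrier K C f (own C f)
  own∈Barrier K C f = directed⇒barrier K (irrefl refl) (inj₂ (refl , refl))

  Barrier-cycle⊆cut : ∀ {C f g} → C f ≢ un → C g ≢ bi → ∀ b → Barrier cycle C f b → Barrier cut C g b
  Barrier-cycle⊆cut {C} ¬un ¬bi b (_ , d) = inj₂ (arc⇒directed {C} ¬bi b (directed⇒arc {C} ¬un b d))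

  Barrier-cut-mono : ∀ {C f g} → f ≺ g → C g ≢ bi → ∀ b → Barrier cut C f b → Barrier cut C g b
  Barrier-cut-mono     f≺g ¬bi b (inj₁ b≺f)               = inj₁ (≺-trans b≺f f≺g)
  Barrier-cut-mono {C} f≺g ¬bi b (inj₂ (inj₁ (_ , Cb)))   = inj₂ (arc⇒directed {C} ¬bi b Cb)
  Barrier-cut-mono     f≺g ¬bi b (inj₂ (inj₂ (refl , _))) = inj₁ f≺g

  Barrier-cycle-anti : ∀ {C f g} → f ≺ g → C g ≢ un → ∀ b → Barrier cycle C g b → Barrier cycle C f b
  Barrier-cycle-anti {C} {f} f≺g ¬un b (b⊀g , d) =
    (λ b≺f → b⊀g (≺-trans b≺f f≺g)) ,
    inj₁ ((λ { refl → b⊀g f≺g }) , directed⇒arc {C} ¬un b d)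

  -- Cycle barriers lie inside cut barriers; cut barriers grow and cycle barriers shrink as the edge
  -- increases. This is the chain that `crossing` relies on.
  Barrier-chain : ∀ {C} K L f g → Admissible K (C f) → Admissible L (C g) →
                  (∀ b → Barrier K C f b → Barrier L C g b) ⊎ (∀ b → Barrier L C g b → Barrier K C f b)
  Barrier-chain cut   cycle f g okf okg = inj₂ (Barrier-cycle⊆cut okg okf)
  Barrier-chain cycle cut   f g okf okg = inj₁ (Barrier-cycle⊆cut okf okg)
  Barrier-chain cut   cut   f g okf okg with compare f g
  ... | B.tri< f≺g _ _  = inj₁ (Barrier-cut-mono f≺g okg)
  ... | B.tri≈ _ refl _ = inj₁ λ _ p → p
  ... | B.tri> _ _ g≺f  = inj₂ (Barrier-cut-mono g≺f okf)
  Barrier-chain cycle cycle f g okf okg with compare f g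
  ... | B.tri< f≺g _ _  = inj₂ (Barrier-cycle-anti f≺g okg)
  ... | B.tri≈ _ refl _ = inj₁ λ _ p → p
  ... | B.tri> _ _ g≺f  = inj₁ (Barrier-cycle-anti g≺f okf)

  module _ (C : Config m) (e : Fin m) where

    SepAt : Kind → Fin m → Status → Set
    SepAt K f s = Sep R (Barrier K C f [ e ≔ s ]) (own C f)

    -- In direction ε, e separates own arcs that it does not separate when
    -- contracted, so e^ε must not be contracted; nor may e^-ε be deleted.
    Pivotal : Sign → Set
    Pivotal ε = ∃[ f ] f ≺ e ×
      ((Admissible cut   (C f) × SepAt cut   f (one ε) × ¬ SepAt cut   f bi) ⊎
       (Admissible cycle (C f) × SepAt cycle f (one ε) × ¬ SepAt cycle f bi))

    pivotal : ∀ {ε} K f → f ≺ e → Admissible K (C f) → SepAt K f (one ε) → ¬ SepAt K f bi → Pivotal ε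
    pivotal cut   f f≺e ok s ¬s = f , f≺e , inj₁ (ok , s , ¬s)
    pivotal cycle f f≺e ok s ¬s = f , f≺e , inj₂ (ok , s , ¬s)

    pivotal⁻ : ∀ {ε} → Pivotal ε →
               ∃[ K ] ∃[ f ] f ≺ e × Admissible K (C f) × SepAt K f (one ε) × ¬ SepAt K f bi
    pivotal⁻ (f , f≺e , inj₁ p) = cut   , f , f≺e , p
    pivotal⁻ (f , f≺e , inj₂ p) = cycle , f , f≺e , p

    sepAt? : ∀ K f s → Dec (SepAt K f s)
    sepAt? K f s = Sep? R (≔? (barrier? K C f) e s) (own C f)

    pivotal? : ∀ ε → Dec (Pivotal ε)
    pivotal? ε = any? λ f → f <? e ×-dec (test cut f ⊎-dec test cycle f)
      where
      test : ∀ K f → Dec (Admissible K (C f) × SepAt K f (one ε) × ¬ SepAt K f bi)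
      test K f = admissible? K (C f) ×-dec sepAt? K f (one ε) ×-dec ¬? (sepAt? K f bi)

    -- Once all edges above e are settled, these are the barriers of `L̂⇔¬Sep` and `Î⇔Sep`, so that
    -- `CutActive` and `CycleActive` are the generalized activities of e.
    Above Around : Pred (Arc m) 0ℓ
    Above  b = e ≺ proj₁ b × arcs C b
    Around b = proj₁ b ≺ e ⊎ Above b

    CutActive CycleActive : Set
    CutActive   = Sep R Around (e , Sign.+)
    CycleActive = ¬ Sep R Above (e , Sign.+)

    cutActive? : Dec CutActive
    cutActive? = Sep? R (λ b → proj₁ b <? e ⊎-dec (e <? proj₁ b ×-dec has? (C (proj₁ b)) (proj₂ b))) (e , Sign.+)

    private
      ¬pivotal²-⊆ : ∀ ε K L f g → f ≺ e → g ≺ e →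
        SepAt K f (one ε) → ¬ SepAt K f bi → SepAt L g (one (opposite ε)) → ¬ SepAt L g bi →
        ¬ (∀ b → Barrier K C f b → Barrier L C g b)
      ¬pivotal²-⊆ ε K L f g f≺e g≺e s ¬s s′ ¬s′ sub =
        crossing R ε (≺⇒≢ sto f≺e) (λ b _ → sub b) (sub (own C f) (own∈Barrier K C f)) s s′ ¬s ¬s′

    -- The two barriers are nested, so `crossing` applies in one order or the other. Hence at least
    -- one arc of e can be contracted safely.
    ¬pivotal² : Pivotal Sign.+ → ¬ Pivotal Sign.-
    ¬pivotal² p⁺ p⁻ with pivotal⁻ p⁺ | pivotal⁻ p⁻
    ... | K , f , f≺e , okf , s , ¬s | L , g , g≺e , okg , s′ , ¬s′ with Barrier-chain {C} K L f g okf okg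
    ...   | inj₁ sub = ¬pivotal²-⊆ Sign.+ K L f g f≺e g≺e s ¬s s′ ¬s′ sub
    ...   | inj₂ sub = ¬pivotal²-⊆ Sign.- L K g f g≺e f≺e s′ ¬s′ s ¬s sub

    cutActive⇒¬cycleActive : CutActive → ¬ CycleActive
    cutActive⇒¬cycleActive s ¬s = ¬s (Sep-antitone R (λ _ → inj₂) s)

    module _ (symmetric : ∀ {h} → e ≺ h → ∀ γ → Has (C h) γ → Has (C h) (opposite γ)) where

      above-reverse : ∀ b → Above b → Above (reverse b)
      above-reverse (h , γ) (e≺h , has) = e≺h , symmetric e≺h γ has

      around-reverse : ∀ b → Around b → Around (reverse b)
      around-reverse b = [ inj₁ , inj₂ ∘ above-reverse b ]′

      Barrier⊆Around : ∀ K f → f ≺ e → ∀ b → proj₁ b ≢ e → Barrier K C f b → Around b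
      Barrier⊆Around K f f≺e b b≢e Bb with compare (proj₁ b) e
      ... | B.tri< b≺e _ _ = inj₁ b≺e
      ... | B.tri≈ _ b≡e _ = contradiction b≡e b≢e
      ... | B.tri> _ _ e≺b with K | Bb
      ...   | cut   | inj₁ b≺f                     = inj₁ (≺-trans b≺f f≺e)
      ...   | cut   | inj₂ (inj₁ (_ , Cb))         = inj₂ (e≺b , Cb)
      ...   | cut   | inj₂ (inj₂ (refl , _))       = inj₁ f≺e
      ...   | cycle | _ , inj₁ (_ , Cb)            = inj₂ (e≺b , Cb)
      ...   | cycle | _ , inj₂ (refl , _)          = inj₁ f≺e

      Above⊆Barrier : ∀ K f → f ≺ e → ∀ b → Above b → Barrier K C f b
      Above⊆Barrier K f f≺e b (e≺b , Cb) =
        directed⇒barrier K (asym f≺b) (inj₁ ((λ b≡f → irrefl (sym b≡f) f≺b) , Cb))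
        where
        f≺b : f ≺ proj₁ b
        f≺b = ≺-trans f≺e e≺b

      -- Cut activity separates e^-ε by `Around`, which contains the barrier of f away from e. If
      -- e^ε were pivotal, `crossing` would make it impossible to rule out a side that e^-ε leaves
      -- with both arcs of e in the barrier; but its reverse enters that side.
      cutActive⇒¬pivotal : CutActive → ∀ ε → ¬ Pivotal ε
      cutActive⇒¬pivotal active ε p with pivotal⁻ p
      ... | K , f , f≺e , _ , s , ¬s =
        crossing R {D′ = Around} ε (≺⇒≢ sto f≺e) (Barrier⊆Around K f f≺e) (inj₁ f≺e)
          s (with-e (Sep-anyDirection R around-reverse Sign.+ (opposite ε) active)) ¬s
          λ (sep X e-exits closed) →
            closed⇒¬enters R closed (e , opposite ε) (inj₂ (refl , _)) e-exits
        where
        with-e : ∀ {δ} → Sep R Around (e , δ) → Sep R (Around [ e ≔ one δ ]) (e , δ)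
        with-e (sep X e-exits closed) = sep X e-exits
          (≔-closed R (λ b _ → closed b) λ { _ refl t∈X → contradiction t∈X (proj₂ e-exits) })

      -- A pivotal arc e^ε leaves a side closed under the barrier of f, which contains all arcs
      -- above e. That side separates e from `Above`.
      cycleActive⇒¬pivotal : CycleActive → ∀ ε → ¬ Pivotal ε
      cycleActive⇒¬pivotal active ε p with pivotal⁻ p
      ... | K , f , f≺e , _ , s , ¬s with exits-pivot R ε s ¬s
      ...   | X , _ , e-exits , closed = active (Sep-anyDirection R above-reverse ε Sign.+
        (sep X e-exits λ b Ab → closed b (inj₁ ((λ b≡e → irrefl (sym b≡e) (proj₁ Ab)) , Above⊆Barrier K f f≺e b Ab))))

    abstract
      -- Whether e⁺ is contracted and e⁻ deleted, rather than the other way round.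
      rule : Bool
      rule = does (pivotal? Sign.- ⊎-dec cutActive?)

      rule⁺ : Pivotal Sign.- ⊎ CutActive → rule ≡ true
      rule⁺ = dec-true (pivotal? Sign.- ⊎-dec cutActive?)

      rule⁻ : rule ≡ true → Pivotal Sign.- ⊎ CutActive
      rule⁻ = does⁻ (pivotal? Sign.- ⊎-dec cutActive?)

    module _ (symmetric : ∀ {h} → e ≺ h → ∀ γ → Has (C h) γ → Has (C h) (opposite γ)) where

      rule⇒¬pivotal⁺ : rule ≡ true → ¬ Pivotal Sign.+
      rule⇒¬pivotal⁺ eq p = [ ¬pivotal² p , (λ active → cutActive⇒¬pivotal symmetric active Sign.+ p) ]′ (rule⁻ eq)

      ¬rule⇒¬pivotal⁻ : rule ≡ false → ¬ Pivotal Sign.-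
      ¬rule⇒¬pivotal⁻ eq p with trans (sym eq) (rule⁺ (inj₁ p))
      ... | ()

      cycleActive⇒¬rule : CycleActive → rule ≡ false
      cycleActive⇒¬rule active = ¬-not λ eq →
        [ cycleActive⇒¬pivotal symmetric active Sign.- , (λ a → cutActive⇒¬cycleActive a active) ]′ (rule⁻ eq)

      -- One implication in each case is monotonicity in the barrier. The other needs only that e⁺
      -- is not pivotal if `rule` is true, and that e⁻ is not pivotal if it is false, for both
      -- orientations that e may have.
      SepAt-settle : ∀ K f → f ≺ e → Admissible K (C f) → ∀ s →
                     SepAt K f s ⇔ SepAt K f (settled (settle rule s))
      SepAt-settle K f f≺e ok = go
        where
        contract : ∀ {ε} → ¬ Pivotal ε → SepAt K f (one ε) → SepAt K f bi
        contract ¬p s = decidable-stable (sepAt? K f bi) (¬p ∘ pivotal K f f≺e ok s)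

        -- A side found with e deleted tolerates e^ε or e^-ε. In the second case e^-ε, not being
        -- pivotal, can be contracted, and a contracted e includes e^ε.
        delete : ∀ {ε} → ¬ Pivotal (opposite ε) → SepAt K f un → SepAt K f (one ε)
        delete {ε} ¬p s = [ id , Sep-bi⇒ R ∘ contract ¬p ]′ (Sep-split R ε s)

        go : ∀ s → SepAt K f s ⇔ SepAt K f (settled (settle rule s))
        go un = mk⇔ id id
        go bi = mk⇔ id id
        go (one Sign.+) with rule in eq
        ... | true  = mk⇔ (contract (rule⇒¬pivotal⁺ eq)) (Sep-bi⇒ R)
        ... | false = mk⇔ (Sep⇒un R) (delete (¬rule⇒¬pivotal⁻ eq))
        go (one Sign.-) with rule in eq
        ... | true  = mk⇔ (Sep⇒un R) (delete (rule⇒¬pivotal⁺ eq))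
        ... | false = mk⇔ (contract (¬rule⇒¬pivotal⁻ eq)) (Sep-bi⇒ R)

-- Well-founded systems of equations

module _ {m : ℕ} {A : Set} (default : A) {_<_ : Rel (Fin m) 0ℓ} (wf : WellFounded _<_)
         (_<?_ : B.Decidable _<_) (F : Fin m → (Fin m → A) → A)
         (F-local : ∀ e {v w} → (∀ h → h < e → v h ≡ w h) → F e v ≡ F e w) where

  private
    Restriction : Fin m → Set
    Restriction e = ∀ {h} → h < e → A

    extend-at : ∀ {e} → Restriction e → ∀ h → Dec (h < e) → A
    extend-at rec h (yes h<e) = rec h<e
    -- By `F-local` the values outside the part below e have no influence, so any element serves.
    extend-at rec h (no _)    = default

    step : ∀ e → Restriction e → A
    step e rec = F e λ h → extend-at rec h (h <? e)

    step-cong : ∀ e {rec rec′ : Restriction e} → (∀ {h} (h<e : h < e) → rec h<e ≡ rec′ h<e) →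
                step e rec ≡ step e rec′
    step-cong e {rec} {rec′} eq = F-local e λ h _ → go h (h <? e)
      where
      go : ∀ h d → extend-at rec h d ≡ extend-at rec′ h d
      go h (yes h<e) = eq h<e
      go h (no _)    = refl

  abstract
    solution : Fin m → A
    solution = WF.All.wfRec wf 0ℓ (λ _ → A) step

    solution-solves : ∀ e → solution e ≡ F e solution
    solution-solves e = trans (WF.FixPoint.unfold-wfRec wf (λ _ → A) step step-cong)
                              (F-local e λ h h<e → below h h<e (h <? e))
      where
      below : ∀ h → h < e → ∀ d → extend-at {e} (λ {h} _ → solution h) h d ≡ solution h
      below h _   (yes _)   = refl
      below h h<e (no h≮e) = contradiction h<e h≮e

  solutions-agree : ∀ {v w} → (∀ e → v e ≡ F e v) → (∀ e → w e ≡ F e w) → ∀ e → v e ≡ w e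
  solutions-agree v-solves w-solves = WF.All.wfRec wf 0ℓ _ λ e ih →
    trans (v-solves e) (trans (F-local e λ h h<e → ih h<e) (sym (w-solves e)))

lookup-injective : ∀ {A : Set} {n} {v w : Vec A n} → (∀ i → lookup v i ≡ lookup w i) → v ≡ w
lookup-injective eq = trans (sym (tabulate∘lookup _)) (trans (tabulate-cong eq) (tabulate∘lookup _))

-- Fourientations as families of statuses

isUn isBi isOne : Status → Bool
isUn un      = true
isUn _       = false
isBi bi      = true
isBi _       = false
isOne (one _) = true
isOne _       = false

isOne⁻ : ∀ s → isOne s ≡ true → ∃[ δ ] s ≡ one δ
isOne⁻ (one δ) _ = δ , refl

isUn⁻ : ∀ s → isUn s ≡ true → s ≡ un
isUn⁻ un _ = refl

isBi⁻ : ∀ s → isBi s ≡ true → s ≡ bi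
isBi⁻ bi _ = refl

-- The inverse of `settle`: the arguments tell whether the edge is oriented, which choice was made
-- at it, and whether it was contracted.
unsettle : Bool → Bool → Bool → Status
unsettle false c     s     = settled s
unsettle true  true  true  = one Sign.+
unsettle true  true  false = one Sign.-
unsettle true  false true  = one Sign.-
unsettle true  false false = one Sign.+

settle-unsettle : ∀ t c s → settle c (unsettle t c s) ≡ s
settle-unsettle false c     true  = refl
settle-unsettle false c     false = refl
settle-unsettle true  true  true  = refl
settle-unsettle true  true  false = refl
settle-unsettle true  false true  = refl
settle-unsettle true  false false = refl

isOne-unsettle : ∀ t c s → isOne (unsettle t c s) ≡ t
isOne-unsettle false c     true  = refl
isOne-unsettle false c     false = refl
isOne-unsettle true  true  true  = refl
isOne-unsettle true  true  false = refl
isOne-unsettle true  false true  = refl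
isOne-unsettle true  false false = refl

unsettle-settle : ∀ c s → unsettle (isOne s) c (settle c s) ≡ s
unsettle-settle c     un           = refl
unsettle-settle c     bi           = refl
unsettle-settle true  (one Sign.+) = refl
unsettle-settle true  (one Sign.-) = refl
unsettle-settle false (one Sign.+) = refl
unsettle-settle false (one Sign.-) = refl

fromBits : Bool → Bool → Status
fromBits true  true  = bi
fromBits true  false = one Sign.+
fromBits false true  = one Sign.-
fromBits false false = un

bit : Sign → Status → Bool
bit _      un           = false
bit _      bi           = true
bit Sign.+ (one Sign.+) = true
bit Sign.+ (one Sign.-) = false
bit Sign.- (one Sign.+) = false
bit Sign.- (one Sign.-) = true

fromBits-bit : ∀ s → fromBits (bit Sign.+ s) (bit Sign.- s) ≡ s
fromBits-bit un           = refl
fromBits-bit bi           = refl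
fromBits-bit (one Sign.+) = refl
fromBits-bit (one Sign.-) = refl

bit⁺-fromBits : ∀ p q → bit Sign.+ (fromBits p q) ≡ p
bit⁺-fromBits true  true  = refl
bit⁺-fromBits true  false = refl
bit⁺-fromBits false true  = refl
bit⁺-fromBits false false = refl

bit⁻-fromBits : ∀ p q → bit Sign.- (fromBits p q) ≡ q
bit⁻-fromBits true  true  = refl
bit⁻-fromBits true  false = refl
bit⁻-fromBits false true  = refl
bit⁻-fromBits false false = refl

Has⇔bit : ∀ s δ → Has s δ ⇔ bit δ s ≡ true
Has⇔bit un           Sign.+ = mk⇔ (λ ()) (λ ())
Has⇔bit un           Sign.- = mk⇔ (λ ()) (λ ())
Has⇔bit bi           Sign.+ = mk⇔ (λ _ → refl) _
Has⇔bit bi           Sign.- = mk⇔ (λ _ → refl) _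
Has⇔bit (one Sign.+) Sign.+ = mk⇔ (λ _ → refl) (λ _ → refl)
Has⇔bit (one Sign.+) Sign.- = mk⇔ (λ ()) (λ ())
Has⇔bit (one Sign.-) Sign.+ = mk⇔ (λ ()) (λ ())
Has⇔bit (one Sign.-) Sign.- = mk⇔ (λ _ → refl) (λ _ → refl)

module _ {m : ℕ} where

  ∈⇔lookup : ∀ {e} {S : Subset m} → e ∈ S ⇔ lookup S e ≡ true
  ∈⇔lookup {e} {S} = mk⇔ []=⇒lookup (lookup⇒[]= e S)

  status : Fourientation m → Config m
  status O e = fromBits (lookup (pos O) e) (lookup (neg O) e)

  fromConfig : Config m → Fourientation m
  fromConfig C = fourientation (tabulate (bit Sign.+ ∘ C)) (tabulate (bit Sign.- ∘ C))

  status-fromConfig : ∀ C e → status (fromConfig C) e ≡ C e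
  status-fromConfig C e = trans
    (cong₂ fromBits (lookup∘tabulate (bit Sign.+ ∘ C) e) (lookup∘tabulate (bit Sign.- ∘ C) e))
    (fromBits-bit (C e))

  status-injective : ∀ {O O′} → (∀ e → status O e ≡ status O′ e) → O ≡ O′
  status-injective {O} {O′} eq = cong₂ fourientation
    (lookup-injective λ e → trans (sym (bit⁺-fromBits _ (lookup (neg O) e)))
      (trans (cong (bit Sign.+) (eq e)) (bit⁺-fromBits _ _)))
    (lookup-injective λ e → trans (sym (bit⁻-fromBits (lookup (pos O) e) _))
      (trans (cong (bit Sign.-) (eq e)) (bit⁻-fromBits (lookup (pos O′) e) _)))

  ∈ᶠ⇔arc : ∀ {O} b → b ∈ᶠ O ⇔ arcs (status O) b
  ∈ᶠ⇔arc {O} (e , Sign.+) = mk⇔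
    (λ e∈ → from (Has⇔bit (status O e) Sign.+) (trans (bit⁺-fromBits _ _) ([]=⇒lookup e∈)))
    (λ has → lookup⇒[]= e _ (trans (sym (bit⁺-fromBits _ _)) (to (Has⇔bit (status O e) Sign.+) has)))
  ∈ᶠ⇔arc {O} (e , Sign.-) = mk⇔
    (λ e∈ → from (Has⇔bit (status O e) Sign.-) (trans (bit⁻-fromBits (lookup (pos O) e) _) ([]=⇒lookup e∈)))
    (λ has → lookup⇒[]= e _ (trans (sym (bit⁻-fromBits (lookup (pos O) e) _)) (to (Has⇔bit (status O e) Sign.-) has)))

  module _ (O : Fourientation m) (e : Fin m) where

    lookup-ᵘ : lookup (O ᵘ) e ≡ isUn (status O e)
    lookup-ᵘ rewrite lookup-map e not (pos O ∪ neg O) | lookup-zipWith _∨_ e (pos O) (neg O)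
      with lookup (pos O) e | lookup (neg O) e
    ... | true  | true  = refl
    ... | true  | false = refl
    ... | false | true  = refl
    ... | false | false = refl

    lookup-ᵇ : lookup (O ᵇ) e ≡ isBi (status O e)
    lookup-ᵇ rewrite lookup-zipWith _∧_ e (pos O) (neg O)
      with lookup (pos O) e | lookup (neg O) e
    ... | true  | true  = refl
    ... | true  | false = refl
    ... | false | true  = refl
    ... | false | false = refl

    lookup-ᵒ : lookup (O ᵒ) e ≡ isOne (status O e)
    lookup-ᵒ rewrite lookup-map e not (O ᵘ ∪ O ᵇ) | lookup-zipWith _∨_ e (O ᵘ) (O ᵇ) | lookup-ᵘ | lookup-ᵇ
      with status O e
    ... | un    = refl
    ... | bi    = refl
    ... | one _ = refl

    status-ᵘ : e ∈ O ᵘ → status O e ≡ un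
    status-ᵘ e∈ = isUn⁻ _ (trans (sym lookup-ᵘ) ([]=⇒lookup e∈))

    status-ᵇ : e ∈ O ᵇ → status O e ≡ bi
    status-ᵇ e∈ = isBi⁻ _ (trans (sym lookup-ᵇ) ([]=⇒lookup e∈))

    status-ᵒ : e ∈ O ᵒ → ∃[ δ ] status O e ≡ one δ
    status-ᵒ e∈ = isOne⁻ _ (trans (sym lookup-ᵒ) ([]=⇒lookup e∈))

    status-⁺ : e ∈ O ⁺ → status O e ≡ one Sign.+
    status-⁺ e∈ with x∈p∩q⁻ (O ᵒ) (pos O) e∈
    ... | e∈ᵒ , e∈pos with status O e | status-ᵒ e∈ᵒ | to (∈ᶠ⇔arc {O} (e , Sign.+)) e∈pos
    ...   | _ | _ , refl | refl = refl

    status-⁻ : e ∈ O ⁻ → status O e ≡ one Sign.-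
    status-⁻ e∈ with x∈p∩q⁻ (O ᵒ) (neg O) e∈
    ... | e∈ᵒ , e∈neg with status O e | status-ᵒ e∈ᵒ | to (∈ᶠ⇔arc {O} (e , Sign.-)) e∈neg
    ...   | _ | _ , refl | refl = refl

  private
    ∪⁅⁆⇔ : ∀ {S : Subset m} {e f} → f ∈ S ∪ ⁅ e ⁆ ⇔ (f ∈ S ⊎ f ≡ e)
    ∪⁅⁆⇔ {S} {e} = mk⇔ ([ inj₁ , inj₂ ∘ x∈⁅y⁆⇒x≡y e ]′ ∘ x∈p∪q⁻ S ⁅ e ⁆)
                       [ p⊆p∪q ⁅ e ⁆ , (λ { refl → q⊆p∪q S ⁅ e ⁆ (x∈⁅x⁆ e) }) ]′

    -⇔ : ∀ {S : Subset m} {e f} → f ∈ S - e ⇔ (f ∈ S × f ≢ e)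
    -⇔ {S} {e} = mk⇔ (λ f∈ → p─q⊆p S ⁅ e ⁆ f∈ , λ { refl → x∈p─q⇒x∉q f∈ (x∈⁅x⁆ e) })
                     (λ (f∈S , f≢e) → x∈p∧x≢y⇒x∈p-y f∈S f≢e)

  ∈ᶠ-insert⇔ : ∀ {O : Fourientation m} a b → b ∈ᶠ insert a O ⇔ (b ∈ᶠ O ⊎ b ≡ a)
  ∈ᶠ-insert⇔ (e , Sign.+) (f , Sign.+) = mk⇔ ([ inj₁ , (λ { refl → inj₂ refl }) ]′ ∘ to ∪⁅⁆⇔)
                                             (from ∪⁅⁆⇔ ∘ [ inj₁ , (λ { refl → inj₂ refl }) ]′)
  ∈ᶠ-insert⇔ (e , Sign.+) (f , Sign.-) = mk⇔ inj₁ [ id , (λ ()) ]′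
  ∈ᶠ-insert⇔ (e , Sign.-) (f , Sign.+) = mk⇔ inj₁ [ id , (λ ()) ]′
  ∈ᶠ-insert⇔ (e , Sign.-) (f , Sign.-) = mk⇔ ([ inj₁ , (λ { refl → inj₂ refl }) ]′ ∘ to ∪⁅⁆⇔)
                                             (from ∪⁅⁆⇔ ∘ [ inj₁ , (λ { refl → inj₂ refl }) ]′)

  ∈ᶠ-remove⇔ : ∀ {O : Fourientation m} a b → b ∈ᶠ remove a O ⇔ (b ∈ᶠ O × b ≢ a)
  ∈ᶠ-remove⇔ (e , Sign.+) (f , Sign.+) = mk⇔ (λ f∈ → proj₁ (to -⇔ f∈) , λ { refl → proj₂ (to -⇔ f∈) refl })
                                             (λ (f∈ , f≢) → from -⇔ (f∈ , λ { refl → f≢ refl }))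
  ∈ᶠ-remove⇔ (e , Sign.+) (f , Sign.-) = mk⇔ (λ f∈ → f∈ , λ ()) proj₁
  ∈ᶠ-remove⇔ (e , Sign.-) (f , Sign.+) = mk⇔ (λ f∈ → f∈ , λ ()) proj₁
  ∈ᶠ-remove⇔ (e , Sign.-) (f , Sign.-) = mk⇔ (λ f∈ → proj₁ (to -⇔ f∈) , λ { refl → proj₂ (to -⇔ f∈) refl })
                                             (λ (f∈ , f≢) → from -⇔ (f∈ , λ { refl → f≢ refl }))

subsets↔ : ∀ m → Subset m ↔ Fin (2 ^ m)
subsets↔ ℕ.zero    = mk↔ₛ′ (λ _ → zero) (λ _ → []) (λ { zero → refl ; (suc ()) }) (λ { [] → refl })
subsets↔ (ℕ.suc m) = ↔-trans uncons↔ (↔-trans (↔-sym 2↔Bool ×-↔ subsets↔ m) (↔-sym *↔×))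
  where
  uncons↔ : Subset (ℕ.suc m) ↔ (Bool × Subset m)
  uncons↔ = mk↔ₛ′ (λ { (x ∷ S) → x , S }) (λ (x , S) → x ∷ S) (λ _ → refl) (λ { (_ ∷ _) → refl })

-- Processing the edges from the largest to the smallest

module Processing {n m : ℕ} {G : Graph n m} (R : ReferenceOrientation G)
         {_≺_ : Rel (Fin m) 0ℓ} (sto : IsStrictTotalOrder _≡_ _≺_)
         (σᵘ σᵇ : Fin m → Sign) where
  open IsStrictTotalOrder sto using (_<?_; irrefl; asym; compare; isStrictPartialOrder) renaming (trans to ≺-trans)
  open Activities R sto σᵘ σᵇ

  abstract
    -- Counting the larger edges gives the position of e in the processing order, with the largest
    -- edge at 0.
    rank : Fin m → ℕ
    rank e = ∣ select (e <?_) ∣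

    rank-anti : ∀ {e f} → e ≺ f → rank f < rank e
    rank-anti {e} {f} e≺f = p⊂q⇒∣p∣<∣q∣
      ( (λ h∈ → ∈-select⁺ (e <?_) (≺-trans e≺f (∈-select⁻ (f <?_) h∈)))
      , f , ∈-select⁺ (e <?_) e≺f , λ f∈ → irrefl refl (∈-select⁻ (f <?_) f∈))

  rank-cancel : ∀ {e f} → rank f < rank e → e ≺ f
  rank-cancel {e} {f} lt with compare e f
  ... | B.tri< e≺f _ _  = e≺f
  ... | B.tri≈ _ refl _ = contradiction lt (ℕ.<-irrefl refl)
  ... | B.tri> _ _ f≺e  = contradiction (rank-anti f≺e) (ℕ.<-asym lt)

  -- The state in which the choice at e is made: smaller edges untouched, larger ones settled, and e
  -- itself overwritten by a placeholder so that the choice cannot depend on its status.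
  mask-at : Config m → (Fin m → Bool) → ∀ e h → B.Tri (h ≺ e) (h ≡ e) (e ≺ h) → Status
  mask-at C S e h (B.tri< _ _ _) = C h
  mask-at C S e h (B.tri≈ _ _ _) = un
  mask-at C S e h (B.tri> _ _ _) = settled (S h)

  -- A vector, so that masks which agree entrywise are equal.
  mask : Config m → (Fin m → Bool) → Fin m → Vec Status m
  mask C S e = tabulate λ h → mask-at C S e h (compare h e)

  masked : Config m → (Fin m → Bool) → Fin m → Config m
  masked C S e = lookup (mask C S e)

  masked-below : ∀ C S {e h} → h ≺ e → masked C S e h ≡ C h
  masked-below C S {e} {h} h≺e = trans (lookup∘tabulate _ h) (go (compare h e))
    where
    go : ∀ t → mask-at C S e h t ≡ C h
    go (B.tri< _ _ _)   = refl
    go (B.tri≈ h⊀e _ _) = contradiction h≺e h⊀e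
    go (B.tri> h⊀e _ _) = contradiction h≺e h⊀e

  masked-above : ∀ C S {e h} → e ≺ h → masked C S e h ≡ settled (S h)
  masked-above C S {e} {h} e≺h = trans (lookup∘tabulate _ h) (go (compare h e))
    where
    go : ∀ t → mask-at C S e h t ≡ settled (S h)
    go (B.tri< _ _ e⊀h) = contradiction e≺h e⊀h
    go (B.tri≈ _ _ e⊀h) = contradiction e≺h e⊀h
    go (B.tri> _ _ _)   = refl

  choice : Config m → (Fin m → Bool) → Fin m → Bool
  choice C S e = rule (masked C S e) e

  -- This locality makes both recursions well-founded: for given C the outcomes are determined from
  -- the largest edge downwards, and for given S the statuses from the smallest edge upwards.
  choice-local : ∀ e {C C′ S S′} → (∀ h → h ≺ e → C h ≡ C′ h) → (∀ h → e ≺ h → S h ≡ S′ h) →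
                 choice C S e ≡ choice C′ S′ e
  choice-local e {C} {C′} {S} {S′} C≡ S≡ = cong (λ v → rule (lookup v) e)
    (tabulate-cong λ h → go h (compare h e))
    where
    go : ∀ h t → mask-at C S e h t ≡ mask-at C′ S′ e h t
    go h (B.tri< h≺e _ _) = C≡ h h≺e
    go h (B.tri≈ _ _ _)   = refl
    go h (B.tri> _ _ e≺h) = cong settled (S≡ h e≺h)

  -- The process as a system of equations, which can be solved for S when C is known, or for C when
  -- S and the oriented edges are known.
  record Outcome (C : Config m) (S : Fin m → Bool) : Set where
    constructor outcome-from
    field
      settles : ∀ e → S e ≡ settle (choice C S e) (C e)

  open Outcome public

  private
    ≺-wf = spo-wellFounded isStrictPartialOrder
    ≻-wf = spo-noetherian isStrictPartialOrder

    outcome-step : Config m → Fin m → (Fin m → Bool) → Bool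
    outcome-step C e S = settle (choice C S e) (C e)

    outcome-local : ∀ C e {S S′} → (∀ h → e ≺ h → S h ≡ S′ h) → outcome-step C e S ≡ outcome-step C e S′
    outcome-local C e S≡ = cong (λ c → settle c (C e)) (choice-local e (λ _ _ → refl) S≡)

    config-step : (S T : Fin m → Bool) → Fin m → Config m → Status
    config-step S T e C = unsettle (T e) (choice C S e) (S e)

    config-local : ∀ S T e {C C′} → (∀ h → h ≺ e → C h ≡ C′ h) → config-step S T e C ≡ config-step S T e C′
    config-local S T e C≡ = cong (λ c → unsettle (T e) c (S e)) (choice-local e C≡ (λ _ _ → refl))

  outcome : Config m → Fin m → Bool
  outcome C = solution true ≻-wf (flip _<?_) (outcome-step C) (outcome-local C)

  outcome-correct : ∀ C → Outcome C (outcome C)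
  outcome-correct C = outcome-from (solution-solves true ≻-wf (flip _<?_) (outcome-step C) (outcome-local C))

  outcome-unique : ∀ {C S S′} → Outcome C S → Outcome C S′ → ∀ e → S e ≡ S′ e
  outcome-unique {C} out out′ =
    solutions-agree true ≻-wf (flip _<?_) (outcome-step C) (outcome-local C) (settles out) (settles out′)

  Outcome-cong : ∀ {C C′ S} → (∀ e → C e ≡ C′ e) → Outcome C S → Outcome C′ S
  Outcome-cong C≡ out = outcome-from λ e →
    trans (settles out e) (cong₂ settle (choice-local e (λ h _ → C≡ h) (λ _ _ → refl)) (C≡ e))

  Outcome-congʳ : ∀ {C S S′} → (∀ e → S e ≡ S′ e) → Outcome C S → Outcome C S′
  Outcome-congʳ {C} S≡ out = outcome-from λ e →
    trans (sym (S≡ e)) (trans (settles out e) (cong (λ c → settle c (C e)) (choice-local e (λ _ _ → refl) (λ h _ → S≡ h))))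

  module _ (S T : Fin m → Bool) where

    config : Config m
    config = solution un ≺-wf _<?_ (config-step S T) (config-local S T)

    config-solves : ∀ e → config e ≡ unsettle (T e) (choice config S e) (S e)
    config-solves = solution-solves un ≺-wf _<?_ (config-step S T) (config-local S T)

    config-outcome : Outcome config S
    config-outcome = outcome-from λ e → sym (trans (cong (settle (choice config S e)) (config-solves e))
                                  (settle-unsettle (T e) (choice config S e) (S e)))

    config-oriented : ∀ e → isOne (config e) ≡ T e
    config-oriented e = trans (cong isOne (config-solves e)) (isOne-unsettle (T e) (choice config S e) (S e))

  -- As `unsettle` undoes `settle`, both configurations solve the same ascending system.
  config-unique : ∀ {C C′ S} → Outcome C S → Outcome C′ S → (∀ e → isOne (C e) ≡ isOne (C′ e)) →
                  ∀ e → C e ≡ C′ e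
  config-unique {C} {C′} {S} out out′ T≡ =
    solutions-agree un ≺-wf _<?_ (config-step S (isOne ∘ C)) (config-local S (isOne ∘ C))
      (λ e → sym (trans (cong (unsettle (isOne (C e)) (choice C S e)) (settles out e)) (unsettle-settle _ (C e))))
      (λ e → sym (trans (cong₂ (λ t → unsettle t (choice C′ S e)) (T≡ e) (settles out′ e)) (unsettle-settle _ (C′ e))))

  -- For `cut` this is activity, but for `cycle` it is the negation of activity, since cycle active
  -- edges are those not separated.
  Active : Kind → Config m → Fin m → Set
  Active K C f = Sep R (Barrier K C f) (own C f)

  directed-cong : ∀ {C C′ f} b → C (proj₁ b) ≡ C′ (proj₁ b) → C f ≡ C′ f → directed C f b → directed C′ f b
  directed-cong (h , γ) Ch≡ Cf≡ (inj₁ (h≢f , has)) = inj₁ (h≢f , subst (λ s → Has s γ) Ch≡ has)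
  directed-cong (h , γ) Ch≡ Cf≡ (inj₂ (h≡f , γ≡))  = inj₂ (h≡f , trans γ≡ (cong (direction _) Cf≡))

  Barrier-cong : ∀ K {C C′ f} b → C (proj₁ b) ≡ C′ (proj₁ b) → C f ≡ C′ f → Barrier K C f b → Barrier K C′ f b
  Barrier-cong cut   {C} b Cb≡ Cf≡ (inj₁ b≺f)  = inj₁ b≺f
  Barrier-cong cut   {C} b Cb≡ Cf≡ (inj₂ d)    = inj₂ (directed-cong {C} b Cb≡ Cf≡ d)
  Barrier-cong cycle {C} b Cb≡ Cf≡ (b⊀f , d) = b⊀f , directed-cong {C} b Cb≡ Cf≡ d

  own-cong : ∀ {C C′ f} → C f ≡ C′ f → own C f ≡ own C′ f
  own-cong {f = f} Cf≡ = cong (λ s → f , direction f s) Cf≡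

  Active-cong : ∀ K {C C′ f} → (∀ h → C h ≡ C′ h) → Active K C f → Active K C′ f
  Active-cong K {C} {C′} {f} C≡ s = subst (Sep R (Barrier K C′ f)) (own-cong {C} {C′} (C≡ f))
    (Sep-antitone R (λ b → Barrier-cong K {C′} {C} b (sym (C≡ (proj₁ b))) (sym (C≡ f))) s)

  -- Since e lies above f, its arcs occur in the barrier of f exactly as its status prescribes. So
  -- the analysis at a single edge applies to any configuration that differs from C at most in e.
  Active⇔SepAt : ∀ K {C C′ e f s} → f ≺ e → C′ e ≡ s → (∀ h → h ≢ e → C′ h ≡ C h) →
                 Active K C′ f ⇔ SepAt C e K f s
  Active⇔SepAt K {C} {C′} {e} {f} {s} f≺e C′e≡s C′≡C = mk⇔
    (subst (Sep R (Barrier K C f [ e ≔ s ])) (own-cong {C′} {C} Cf≡) ∘ Sep-antitone R into)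
    (subst (Sep R (Barrier K C′ f)) (own-cong {C} {C′} (sym Cf≡)) ∘ Sep-antitone R out)
    where
    Cf≡ : C′ f ≡ C f
    Cf≡ = C′≡C f (≺⇒≢ sto f≺e)
    into : ∀ b → (Barrier K C f [ e ≔ s ]) b → Barrier K C′ f b
    into b (inj₁ (b≢e , Bb)) = Barrier-cong K {C} {C′} b (sym (C′≡C _ b≢e)) (sym Cf≡) Bb
    into (_ , γ) (inj₂ (refl , has)) = directed⇒barrier K (asym f≺e)
      (inj₁ (≺⇒≢ sto f≺e ∘ sym , subst (λ s → Has s γ) (sym C′e≡s) has))
    at-e : ∀ {γ} → directed C′ f (e , γ) → Has s γ
    at-e {γ} (inj₁ (_ , has))   = subst (λ s → Has s γ) C′e≡s has
    at-e     (inj₂ (refl , _)) = contradiction refl (≺⇒≢ sto f≺e)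
    out : ∀ b → Barrier K C′ f b → (Barrier K C f [ e ≔ s ]) b
    out b@(h , γ) Bb with h ≟ e
    ... | no h≢e = inj₁ (h≢e , Barrier-cong K {C′} {C} b (C′≡C h h≢e) Cf≡ Bb)
    ... | yes refl = inj₂ (refl , at-e (barrier⇒directed K (asym f≺e) Bb))

  -- Invariance of the activities during processing

  settled-symmetric : ∀ s γ → Has (settled s) γ → Has (settled s) (opposite γ)
  settled-symmetric true _ _ = _

  module _ {C : Config m} {S : Fin m → Bool} (out : Outcome C S) where

    masked-symmetric : ∀ e {h} → e ≺ h → ∀ γ → Has (masked C S e h) γ → Has (masked C S e h) (opposite γ)
    masked-symmetric e e≺h γ rewrite masked-above C S e≺h = settled-symmetric (S _) γ

    -- The edges of rank less than k have been deleted or contracted.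
    stage-at : ∀ k h → Dec (rank h < k) → Status
    stage-at k h (yes _) = settled (S h)
    stage-at k h (no _)  = C h

    abstract
      stage : ℕ → Config m
      stage k h = stage-at k h (rank h ℕ.<? k)

      stage-done : ∀ {k h} → rank h < k → stage k h ≡ settled (S h)
      stage-done {k} {h} lt with rank h ℕ.<? k
      ... | yes _ = refl
      ... | no ≮ = contradiction lt ≮

      stage-todo : ∀ {k h} → ¬ rank h < k → stage k h ≡ C h
      stage-todo {k} {h} ≮ with rank h ℕ.<? k
      ... | yes lt = contradiction lt ≮
      ... | no _   = refl

    stage-suc : ∀ {k} → (∀ e → rank e ≢ k) → ∀ h → stage k h ≡ stage (ℕ.suc k) h
    stage-suc {k} none h with rank h ℕ.<? k
    ... | yes lt = trans (stage-done lt) (sym (stage-done (ℕ.m<n⇒m<1+n lt)))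
    ... | no ≮   = trans (stage-todo ≮)
      (sym (stage-todo λ lt → none h (ℕ.≤-antisym (ℕ.s≤s⁻¹ lt) (ℕ.≮⇒≥ ≮))))

    -- The stages just before and just after the step at e can thus both be described by the mask on
    -- which the choice at e is based.
    stage-masked : ∀ e {k} → k ≡ rank e ⊎ k ≡ ℕ.suc (rank e) → ∀ h → h ≢ e → stage k h ≡ masked C S e h
    stage-masked e {k} k≡ h h≢e with compare h e
    ... | B.tri≈ _ h≡e _ = contradiction h≡e h≢e
    ... | B.tri< h≺e _ _ = trans (stage-todo (ℕ.≤⇒≯ (bound k≡))) (sym (masked-below C S h≺e))
      where
      bound : k ≡ rank e ⊎ k ≡ ℕ.suc (rank e) → k ≤ rank h
      bound (inj₁ refl) = ℕ.<⇒≤ (rank-anti h≺e)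
      bound (inj₂ refl) = rank-anti h≺e
    ... | B.tri> _ _ e≺h = trans (stage-done (bound k≡)) (sym (masked-above C S e≺h))
      where
      bound : k ≡ rank e ⊎ k ≡ ℕ.suc (rank e) → rank h < k
      bound (inj₁ refl) = rank-anti e≺h
      bound (inj₂ refl) = ℕ.m<n⇒m<1+n (rank-anti e≺h)

    -- Induction on k. The bound by `rank f` ensures that every edge processed so far lies above f,
    -- where `SepAt-settle` applies.
    stage-preserves : ∀ K f → Admissible K (C f) → ∀ k → k ≤ rank f → Active K C f ⇔ Active K (stage k) f
    stage-preserves K f ok ℕ.zero    _  = mk⇔ (Active-cong K λ h → sym (stage-todo {0} {h} λ ()))
                                              (Active-cong K λ h → stage-todo {0} {h} λ ())
    stage-preserves K f ok (ℕ.suc k) k< with stage-preserves K f ok k (ℕ.<⇒≤ k<) | any? (λ e → rank e ℕ.≟ k)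
    ... | ih | no none =
      mk⇔ (Active-cong K same ∘ to ih) (from ih ∘ Active-cong K (sym ∘ same))
      where
      same : ∀ h → stage k h ≡ stage (ℕ.suc k) h
      same = stage-suc λ e eq → none (e , eq)
    ... | ih | yes (e , refl) =
      mk⇔ (from after ∘ to during ∘ to before ∘ to ih) (from ih ∘ from before ∘ from during ∘ to after)
      where
      f≺e : f ≺ e
      f≺e = rank-cancel k<
      M : Config m
      M = masked C S e
      before : Active K (stage (rank e)) f ⇔ SepAt M e K f (C e)
      before = Active⇔SepAt K f≺e (stage-todo (ℕ.<-irrefl refl)) (stage-masked e (inj₁ refl))
      during : SepAt M e K f (C e) ⇔ SepAt M e K f (settled (settle (choice C S e) (C e)))
      during = SepAt-settle M e (masked-symmetric e) K f f≺e
                 (subst (Admissible K) (sym (masked-below C S f≺e)) ok) (C e)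
      after : Active K (stage (ℕ.suc (rank e))) f ⇔ SepAt M e K f (settled (settle (choice C S e) (C e)))
      after = Active⇔SepAt K f≺e (trans (stage-done (ℕ.n<1+n (rank e))) (cong settled (settles out e)))
                (stage-masked e (inj₂ refl))

    module _ (f : Fin m) where

      private
        final : Config m
        final = stage (rank f)

        final-own : final f ≡ C f
        final-own = stage-todo (ℕ.<-irrefl refl)

        final-above : ∀ {h γ} → f ≺ h → Has (final h) γ ⇔ S h ≡ true
        final-above {h} {γ} f≺h = mk⇔
          (λ has → has-settled (subst (λ s → Has s γ) eq has))
          (λ Sh → subst (λ s → Has s γ) (sym (trans eq (cong settled Sh))) _)
          where eq = stage-done (rank-anti f≺h)

        -- The own arc of f may be added to or dropped from the barrier: a side that it leaves is
        -- not entered by it.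
        separated⇔ : ∀ {K D} → (∀ b → Barrier K final f b → D b ⊎ b ≡ own C f) → (∀ b → D b → Barrier K final f b) →
                     Active K final f ⇔ Sep R D (own C f)
        separated⇔ {K} {D} B⊆D D⊆B = mk⇔
          (Sep-antitone R D⊆B ∘ subst (Sep R (Barrier K final f)) own≡)
          (λ s → subst (Sep R (Barrier K final f)) (sym own≡) (add-own s))
          where
          own≡ : own final f ≡ own C f
          own≡ = own-cong {final} {C} final-own
          add-own : Sep R D (own C f) → Sep R (Barrier K final f) (own C f)
          add-own (sep X a-exits closed) = sep X a-exits λ b Bb t∈X →
            [ (λ Db → closed b Db t∈X) , (λ { refl → contradiction t∈X (proj₂ a-exits) }) ]′ (B⊆D b Bb)

        directed⇒ : ∀ b → directed final f b → (proj₁ b ≺ f ⊎ f ≺ proj₁ b × S (proj₁ b) ≡ true) ⊎ b ≡ own C f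
        directed⇒ (h , γ) (inj₂ (refl , refl)) = inj₂ (own-cong {final} {C} final-own)
        directed⇒ (h , γ) (inj₁ (h≢f , has)) with compare h f
        ... | B.tri< h≺f _ _ = inj₁ (inj₁ h≺f)
        ... | B.tri≈ _ h≡f _ = contradiction h≡f h≢f
        ... | B.tri> _ _ f≺h = inj₁ (inj₂ (f≺h , to (final-above f≺h) has))

        ⇒directed : ∀ b → f ≺ proj₁ b → S (proj₁ b) ≡ true → directed final f b
        ⇒directed (h , γ) f≺h Sh = inj₁ (≺⇒≢ sto f≺h ∘ sym , from (final-above f≺h) Sh)

      -- At stage `rank f` all edges above f are settled, so up to the own arc of f its barrier is
      -- the set in `Î⇔Sep`.
      cutActive⇔ : C f ≢ bi → Active cut C f ⇔
        Sep R (λ b → proj₁ b ≺ f ⊎ f ≺ proj₁ b × S (proj₁ b) ≡ true) (own C f)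
      cutActive⇔ ¬bi = mk⇔ (to last ∘ to all) (from all ∘ from last)
        where
        all = stage-preserves cut f ¬bi (rank f) ℕ.≤-refl
        last = separated⇔ {cut}
          (λ b → [ inj₁ ∘ inj₁ , directed⇒ b ]′)
          (λ b → [ inj₁ , (λ (f≺b , Sb) → inj₂ (⇒directed b f≺b Sb)) ]′)

      cycleSeparated⇔ : C f ≢ un → Active cycle C f ⇔
        Sep R (λ b → f ≺ proj₁ b × S (proj₁ b) ≡ true) (own C f)
      cycleSeparated⇔ ¬un = mk⇔ (to last ∘ to all) (from all ∘ from last)
        where
        all = stage-preserves cycle f ¬un (rank f) ℕ.≤-refl
        last = separated⇔ {cycle}
          (λ b (b⊀f , d) → [ [ (λ b≺f → contradiction b≺f b⊀f) , inj₁ ]′ , inj₂ ]′ (directed⇒ b d))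
          (λ b (f≺b , Sb) → asym f≺b , ⇒directed b f≺b Sb)

-- The map φ, its fibres and the comparison of activities

opposite-≢ : ∀ δ → opposite δ ≢ δ
opposite-≢ Sign.+ ()
opposite-≢ Sign.- ()

≢⇒opposite : ∀ {γ δ} → γ ≢ δ → γ ≡ opposite δ
≢⇒opposite {γ} {δ} γ≢δ with δ≡⊎opposite δ γ
... | inj₁ γ≡δ = contradiction γ≡δ γ≢δ
... | inj₂ γ≡  = γ≡

module Bijection {n m : ℕ} {G : Graph n m} (R : ReferenceOrientation G)
         {_≺_ : Rel (Fin m) 0ℓ} (sto : IsStrictTotalOrder _≡_ _≺_)
         (σᵘ σᵇ : Fin m → Sign) where
  open IsStrictTotalOrder sto using (_<?_; asym; compare)
  open Activities R sto σᵘ σᵇ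
  open Processing R sto σᵘ σᵇ

  φ : Fourientation m → Subset m
  φ O = tabulate (outcome (status O))

  φ-outcome : ∀ O → Outcome (status O) (lookup (φ O))
  φ-outcome O = Outcome-congʳ (λ e → sym (lookup∘tabulate _ e)) (outcome-correct (status O))

  φ-unique : ∀ {O S} → Outcome (status O) (lookup S) → φ O ≡ S
  φ-unique {O} out = lookup-injective (outcome-unique (φ-outcome O) out)

  ⟨φ,ᵒ⟩ : Fourientation m → Subset m × Subset m
  ⟨φ,ᵒ⟩ O = φ O , O ᵒ

  ⟨φ,ᵒ⟩-injective : Injective _≡_ _≡_ ⟨φ,ᵒ⟩
  ⟨φ,ᵒ⟩-injective {O} {O′} eq with Product.,-injective eq
  ... | φ≡ , ᵒ≡ = status-injective (config-unique (φ-outcome O)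
    (subst (Outcome (status O′) ∘ lookup) (sym φ≡) (φ-outcome O′))
    λ e → trans (sym (lookup-ᵒ O e)) (trans (cong (λ S → lookup S e) ᵒ≡) (lookup-ᵒ O′ e)))

  preimage : Subset m → Subset m → Fourientation m
  preimage S T = fromConfig (config (lookup S) (lookup T))

  ⟨φ,ᵒ⟩-preimage : ∀ S T → ⟨φ,ᵒ⟩ (preimage S T) ≡ (S , T)
  ⟨φ,ᵒ⟩-preimage S T = cong₂ _,_
    (φ-unique {preimage S T} (Outcome-cong (λ e → sym (status-fromConfig C e)) (config-outcome (lookup S) (lookup T))))
    (lookup-injective λ e → trans (lookup-ᵒ (preimage S T) e)
      (trans (cong isOne (status-fromConfig C e)) (config-oriented (lookup S) (lookup T) e)))
    where
    C : Config m
    C = config (lookup S) (lookup T)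

  ⟨φ,ᵒ⟩-bijective : Bijective _≡_ _≡_ ⟨φ,ᵒ⟩
  ⟨φ,ᵒ⟩-bijective = ⟨φ,ᵒ⟩-injective , λ (S , T) → preimage S T , λ { refl → ⟨φ,ᵒ⟩-preimage S T }

  φ-surjective : Surjective _≡_ _≡_ φ
  -- Any set of oriented edges can be prescribed here; S itself is at hand.
  φ-surjective S = preimage S S , λ { refl → cong proj₁ (⟨φ,ᵒ⟩-preimage S S) }

  -- By the bijection, a fibre is parametrized by the sets of oriented edges.
  fibre↔ : ∀ S → (∃[ O ] φ O ≡ S) ↔ Fin (2 ^ m)
  fibre↔ S = ↔-trans (mk↔ₛ′ (λ (O , _) → O ᵒ) fibre-at
                            (λ T → cong proj₂ (⟨φ,ᵒ⟩-preimage S T))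
                            (λ { (O , refl) → fibre-≡ (⟨φ,ᵒ⟩-injective (⟨φ,ᵒ⟩-preimage S (O ᵒ))) }))
                     (subsets↔ m)
    where
    fibre-at : Subset m → ∃[ O ] φ O ≡ S
    fibre-at T = preimage S T , cong proj₁ (⟨φ,ᵒ⟩-preimage S T)
    fibre-≡ : ∀ {O O′} {p : φ O ≡ S} {q : φ O′ ≡ S} → O ≡ O′ → _≡_ {A = ∃[ O ] φ O ≡ S} (O , p) (O′ , q)
    -- Equality of subsets is decidable, so the proofs attached to O coincide.
    fibre-≡ {O} refl = cong (O ,_) (Decidable⇒UIP.≡-irrelevant (Vec.≡-dec Bool._≟_) _ _)

  -- A common form for the three fourientations in which the activity of f is tested: O itself, O
  -- with an arc of f inserted, and O with one removed.
  record Represents (O : Fourientation m) (C : Config m) (f : Fin m) : Set where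
    constructor represents
    field
      ∈⇔directed : ∀ b → b ∈ᶠ O ⇔ directed C f b

  represents-oriented : ∀ O {f δ} → status O f ≡ one δ → Represents O (status O) f
  represents-oriented O {f} eq = represents λ b → mk⇔
    (arc⇒directed {status O} {f} (subst (_≢ bi) (sym eq) λ ()) b ∘ to (∈ᶠ⇔arc b))
    (from (∈ᶠ⇔arc b) ∘ directed⇒arc {status O} {f} (subst (_≢ un) (sym eq) λ ()) b)

  represents-insert : ∀ O {f} → status O f ≡ un → Represents (insert (f , σᵘ f) O) (status O) f
  represents-insert O {f} eq = represents λ b → mk⇔
    ([ old b , (λ { refl → inj₂ (refl , sym own≡) }) ]′ ∘ to (∈ᶠ-insert⇔ (f , σᵘ f) b))
    (from (∈ᶠ-insert⇔ (f , σᵘ f) b) ∘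
      [ inj₁ ∘ from (∈ᶠ⇔arc b) ∘ proj₂ , (λ { (refl , γ≡) → inj₂ (cong (f ,_) (trans γ≡ own≡)) }) ]′)
    where
    own≡ : direction f (status O f) ≡ σᵘ f
    own≡ = cong (direction f) eq
    old : ∀ b → b ∈ᶠ O → directed (status O) f b
    old b@(h , γ) b∈O = inj₁ ((λ { refl → subst (λ s → Has s γ) eq has }) , has)
      where has = to (∈ᶠ⇔arc {O = O} b) b∈O

  represents-remove : ∀ O {f} → status O f ≡ bi → Represents (remove (f , σᵇ f) O) (status O) f
  represents-remove O {f} eq = represents λ b → mk⇔ (into b ∘ to (∈ᶠ-remove⇔ (f , σᵇ f) b))
                                            (from (∈ᶠ-remove⇔ (f , σᵇ f) b) ∘ out b)
    where
    own≡ : direction f (status O f) ≡ opposite (σᵇ f)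
    own≡ = cong (direction f) eq
    into : ∀ b → b ∈ᶠ O × b ≢ (f , σᵇ f) → directed (status O) f b
    into b@(h , γ) (b∈O , b≢) with h ≟ f
    ... | no h≢f   = inj₁ (h≢f , to (∈ᶠ⇔arc {O = O} b) b∈O)
    ... | yes refl = inj₂ (refl , trans (≢⇒opposite (b≢ ∘ cong (f ,_))) (sym own≡))
    out : ∀ b → directed (status O) f b → b ∈ᶠ O × b ≢ (f , σᵇ f)
    out b@(h , γ) (inj₁ (h≢f , has)) = from (∈ᶠ⇔arc b) has , h≢f ∘ cong proj₁
    out b@(h , γ) (inj₂ (refl , γ≡)) =
      from (∈ᶠ⇔arc b) (subst (λ s → Has s γ) (sym eq) _) ,
      λ { refl → opposite-≢ (σᵇ f) (trans (sym own≡) (sym γ≡)) }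

  module _ {O C f} (represented : Represents O C f) where

    private
      rep = Represents.∈⇔directed represented

      δ : Sign
      δ = direction f (C f)

      opposite∉ : ¬ ((f , opposite δ) ∈ᶠ O)
      opposite∉ ∈O with to (rep (f , opposite δ)) ∈O
      ... | inj₁ (f≢f , _) = f≢f refl
      ... | inj₂ (_ , eq)  = opposite-≢ δ eq

      own∈ : (f , δ) ∈ᶠ O
      own∈ = from (rep (f , δ)) (inj₂ (refl , refl))

    minOfPotentialCut⇔active : MinOfPotentialCut R _≺_ O f ⇔ Active cut C f
    minOfPotentialCut⇔active = mk⇔
      (Sep-antitone R (λ b → [ inj₁ , inj₂ ∘ from (rep b) ]′) ∘ to min⇔)
      (from min⇔ ∘ Sep-antitone R (λ b → [ inj₁ , inj₂ ∘ to (rep b) ]′))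
      where min⇔ = MinOfPotentialCut⇔Sep R sto O δ opposite∉ own∈

    minOfPotentialCycle⇔¬separated : MinOfPotentialCycle R _≺_ O f ⇔ (¬ Active cycle C f)
    minOfPotentialCycle⇔¬separated = mk⇔
      (λ min s → to min⇔ min (Sep-antitone R (λ b (f≺b , b∈O) → asym f≺b , to (rep b) b∈O) s))
      (λ ¬s → from min⇔ λ (sep X a-exits closed) → ¬s (sep X a-exits λ b (b⊀f , d) →
        [ (λ f≺b → closed b (f≺b , from (rep b) d)) , (λ { refl t∈X → contradiction t∈X (proj₂ a-exits) }) ]′
          (above⊎own b b⊀f d)))
      where
      min⇔ = MinOfPotentialCycle⇔¬Sep R sto O δ opposite∉ own∈
      above⊎own : ∀ b → ¬ (proj₁ b ≺ f) → directed C f b → f ≺ proj₁ b ⊎ b ≡ own C f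
      above⊎own b b⊀f (inj₂ (refl , refl)) = inj₂ refl
      above⊎own b b⊀f (inj₁ (b≢f , _)) with compare (proj₁ b) f
      ... | B.tri< b≺f _ _ = contradiction b≺f b⊀f
      ... | B.tri≈ _ b≡f _ = contradiction b≡f b≢f
      ... | B.tri> _ _ f≺b = inj₁ f≺b

  module _ (O : Fourientation m) where

    private
      C : Config m
      C = status O

      S : Subset m
      S = φ O

      M : Fin m → Config m
      M = masked C (lookup S)

    Î⇔active : ∀ f → C f ≢ bi → Î G _≺_ S f ⇔ Active cut C f
    Î⇔active f ¬bi = mk⇔
      (from active⇔ ∘ Sep-antitone R (λ _ → [ inj₁ , (λ (f≺b , Sb) → inj₂ (f≺b , from ∈⇔lookup Sb)) ]′) ∘ to Î⇔)
      (from Î⇔ ∘ Sep-antitone R (λ _ → [ inj₁ , (λ (f≺b , Sb) → inj₂ (f≺b , to ∈⇔lookup Sb)) ]′) ∘ to active⇔)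
      where
      active⇔ = cutActive⇔ (φ-outcome O) f ¬bi
      Î⇔ = Î⇔Sep R sto S f (direction f (C f))

    L̂⇔¬separated : ∀ f → C f ≢ un → L̂ G _≺_ S f ⇔ (¬ Active cycle C f)
    L̂⇔¬separated f ¬un = mk⇔
      (λ l s → to L̂⇔ l (Sep-antitone R (λ _ (f≺b , Sb) → f≺b , to ∈⇔lookup Sb) (to separated⇔ s)))
      (λ ¬s → from L̂⇔ λ s → ¬s (from separated⇔ (Sep-antitone R (λ _ (f≺b , Sb) → f≺b , from ∈⇔lookup Sb) s)))
      where
      separated⇔ = cycleSeparated⇔ (φ-outcome O) f ¬un
      L̂⇔ = L̂⇔¬Sep R sto S f (direction f (C f))

    private
      above⇔ : ∀ f b → Above (M f) f b ⇔ (f ≺ proj₁ b × proj₁ b ∈ S)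
      above⇔ f (h , γ) = mk⇔
        (λ (f≺h , has) → f≺h , from ∈⇔lookup
          (has-settled (subst (λ s → Has s γ) (masked-above C (lookup S) f≺h) has)))
        (λ (f≺h , h∈S) → f≺h , subst (λ s → Has s γ)
          (sym (trans (masked-above C (lookup S) f≺h) (cong settled (to ∈⇔lookup h∈S)))) _)

    -- Cut activity with respect to φ(O) is one of the two alternatives behind `rule`. With
    -- `L̂⇒¬choice` this yields property (d).
    Î⇒choice : ∀ f → Î G _≺_ S f → choice C (lookup S) f ≡ true
    Î⇒choice f i = rule⁺ (M f) f (inj₂
      (Sep-antitone R (λ b → [ inj₁ , inj₂ ∘ to (above⇔ f b) ]′) (to (Î⇔Sep R sto S f Sign.+) i)))

    L̂⇒¬choice : ∀ f → L̂ G _≺_ S f → choice C (lookup S) f ≡ false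
    L̂⇒¬choice f l = cycleActive⇒¬rule (M f) f (masked-symmetric (φ-outcome O) f) λ s →
      to (L̂⇔¬Sep R sto S f Sign.+) l (Sep-antitone R (λ b → from (above⇔ f b)) s)

    ∈φ⁺ : ∀ {e c s} → C e ≡ s → choice C (lookup S) e ≡ c → settle c s ≡ true → e ∈ S
    ∈φ⁺ {e} refl refl eq = from ∈⇔lookup (trans (settles (φ-outcome O) e) eq)

    ∉φ⁺ : ∀ {e c s} → C e ≡ s → choice C (lookup S) e ≡ c → settle c s ≡ false → e ∉ S
    ∉φ⁺ {e} refl refl eq e∈ with trans (sym (to ∈⇔lookup e∈)) (trans (settles (φ-outcome O) e) eq)
    ... | ()

    unoriented∩φ : O ᵘ ∩ S ≡ ⊥
    unoriented∩φ = Empty-unique λ (e , e∈) → let e∈ᵘ , e∈S = x∈p∩q⁻ (O ᵘ) S e∈ in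
      ∉φ⁺ (status-ᵘ O e e∈ᵘ) refl refl e∈S

    bioriented⊆φ : O ᵇ ⊆ S
    bioriented⊆φ {e} e∈ᵇ = ∈φ⁺ (status-ᵇ O e e∈ᵇ) refl refl

    -- Only oriented edges consult the choice; the others are settled by their status alone.
    φ-no-oriented : O ᵒ ≡ ⊥ → S ≡ O ᵇ
    φ-no-oriented ᵒ≡⊥ = lookup-injective λ e → trans (settles (φ-outcome O) e) (trans
      (go (C e) (trans (sym (lookup-ᵒ O e)) (trans (cong (λ T → lookup T e) ᵒ≡⊥) (lookup-replicate e false))))
      (sym (lookup-ᵇ O e)))
      where
      go : ∀ {c} s → isOne s ≡ false → settle c s ≡ isBi s
      go un _ = refl
      go bi _ = refl

  Î? : ∀ S → Decidable (Î G _≺_ S)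
  Î? S e = map′ (from ⇔sep) (to ⇔sep)
    (Sep? R (λ b → proj₁ b <? e ⊎-dec (e <? proj₁ b ×-dec proj₁ b ∈? S)) (e , Sign.+))
    where ⇔sep = Î⇔Sep R sto S e Sign.+

  L̂? : ∀ S → Decidable (L̂ G _≺_ S)
  L̂? S e = map′ (from ⇔sep) (to ⇔sep)
    (¬? (Sep? R (λ b → e <? proj₁ b ×-dec proj₁ b ∈? S) (e , Sign.+)))
    where ⇔sep = L̂⇔¬Sep R sto S e Sign.+

-- The activities as subsets, and properties (a) to (e)

select-∩-≐ : ∀ {n} {P Q : Pred (Fin n) 0ℓ} (P? : Decidable P) T → (∀ e → e ∈ T → P e ⇔ Q e) →
             ⟦ select P? ∩ T ⟧ ≐ (λ e → e ∈ T × Q e)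
select-∩-≐ P? T P⇔Q =
  (λ e∈ → let e∈P , e∈T = x∈p∩q⁻ (select P?) T e∈ in e∈T , to (P⇔Q _ e∈T) (∈-select⁻ P? e∈P)) ,
  (λ (e∈T , Qe) → x∈p∩q⁺ (∈-select⁺ P? (from (P⇔Q _ e∈T) Qe) , e∈T))

⇔-trans-sym : ∀ {A B C : Set} → A ⇔ B → C ⇔ B → A ⇔ C
⇔-trans-sym f g = mk⇔ (from g ∘ to f) (from f ∘ to g)

theorem3p6 : ∀ {n m : ℕ} (G : Graph n m) (R : ReferenceOrientation G)
    (_≺_ : Rel (Fin m) 0ℓ) → IsStrictTotalOrder _≡_ _≺_ →
    (σᵘ σᵇ : Fin m → Sign) →
    Σ[ φ ∈ (Fourientation m → Subset m) ]
    Surjective _≡_ _≡_ φ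
    × (∀ S → (∃[ O ] φ O ≡ S) ↔ Fin (2 ^ m))
    × Bijective _≡_ _≡_ (λ O → (φ O , O ᵒ))
    × (∀ O → (O ᵘ ∩ φ O ≡ ⊥) × (O ᵇ ⊆ φ O))
    × (Σ[ I ∈ (Fourientation m → Subset m) ] Σ[ L ∈ (Fourientation m → Subset m) ]
    (∀ O → (⟦ I O ⟧ ≐ Î G _≺_ (φ O)) × (⟦ L O ⟧ ≐ L̂ G _≺_ (φ O)))
    × (∀ O → (⟦ I O ∩ O ᵒ ⟧ ≐ Iᵒ R _≺_ O)
    × (⟦ I O ∩ O ᵘ ⟧ ≐ Iᵘ R _≺_ σᵘ O)
    × (⟦ L O ∩ O ᵒ ⟧ ≐ Lᵒ R _≺_ O)
    × (⟦ L O ∩ O ᵇ ⟧ ≐ Lᵇ R _≺_ σᵇ O))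
    × (∀ O → (I O ∩ O ⁺ ⊆ φ O)
    × ((I O ∩ O ⁻) ∩ φ O ≡ ⊥)
    × (L O ∩ O ⁻ ⊆ φ O)
    × ((L O ∩ O ⁺) ∩ φ O ≡ ⊥))
    × (∀ O → O ᵒ ≡ ⊥ → (⟦ I O ⟧ ≐ Î G _≺_ (O ᵇ)) × (⟦ L O ⟧ ≐ L̂ G _≺_ (O ᵇ))))
theorem3p6 {n} {m} G R _≺_ sto σᵘ σᵇ =
  φ , φ-surjective , fibre↔ , ⟨φ,ᵒ⟩-bijective ,
  (λ O → unoriented∩φ O , bioriented⊆φ O) ,
  I , L , (λ O → I≐ O , L≐ O) ,
  (λ O → select-∩-≐ (Î? (φ O)) (O ᵒ) (I-oriented O)
       , select-∩-≐ (Î? (φ O)) (O ᵘ) (I-unoriented O)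
       , select-∩-≐ (L̂? (φ O)) (O ᵒ) (L-oriented O)
       , select-∩-≐ (L̂? (φ O)) (O ᵇ) (L-bioriented O)) ,
  (λ O → (λ {e} e∈ → let e∈I , e∈⁺ = x∈p∩q⁻ (I O) (O ⁺) e∈ in
             ∈φ⁺ O (status-⁺ O e e∈⁺) (Î⇒choice O e (∈-select⁻ (Î? (φ O)) e∈I)) refl)
       , Empty-unique (λ (e , e∈) → let e∈I⁻ , e∈φ = x∈p∩q⁻ (I O ∩ O ⁻) (φ O) e∈
                                        e∈I , e∈⁻ = x∈p∩q⁻ (I O) (O ⁻) e∈I⁻ in
             ∉φ⁺ O (status-⁻ O e e∈⁻) (Î⇒choice O e (∈-select⁻ (Î? (φ O)) e∈I)) refl e∈φ)
       , (λ {e} e∈ → let e∈L , e∈⁻ = x∈p∩q⁻ (L O) (O ⁻) e∈ in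
             ∈φ⁺ O (status-⁻ O e e∈⁻) (L̂⇒¬choice O e (∈-select⁻ (L̂? (φ O)) e∈L)) refl)
       , Empty-unique (λ (e , e∈) → let e∈L⁺ , e∈φ = x∈p∩q⁻ (L O ∩ O ⁺) (φ O) e∈
                                        e∈L , e∈⁺ = x∈p∩q⁻ (L O) (O ⁺) e∈L⁺ in
             ∉φ⁺ O (status-⁺ O e e∈⁺) (L̂⇒¬choice O e (∈-select⁻ (L̂? (φ O)) e∈L)) refl e∈φ)) ,
  (λ O ᵒ≡⊥ → subst (λ S → ⟦ I O ⟧ ≐ Î G _≺_ S) (φ-no-oriented O ᵒ≡⊥) (I≐ O)
           , subst (λ S → ⟦ L O ⟧ ≐ L̂ G _≺_ S) (φ-no-oriented O ᵒ≡⊥) (L≐ O))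
  where
  open Bijection R sto σᵘ σᵇ

  I L : Fourientation m → Subset m
  I O = select (Î? (φ O))
  L O = select (L̂? (φ O))

  I≐ : ∀ O → ⟦ I O ⟧ ≐ Î G _≺_ (φ O)
  I≐ O = ∈-select⁻ (Î? (φ O)) , ∈-select⁺ (Î? (φ O))

  L≐ : ∀ O → ⟦ L O ⟧ ≐ L̂ G _≺_ (φ O)
  L≐ O = ∈-select⁻ (L̂? (φ O)) , ∈-select⁺ (L̂? (φ O))

  I-oriented : ∀ O e → e ∈ O ᵒ → Î G _≺_ (φ O) e ⇔ MinOfPotentialCut R _≺_ O e
  I-oriented O e e∈ᵒ with status-ᵒ O e e∈ᵒ
  ... | δ , eq = ⇔-trans-sym (Î⇔active O e (subst (_≢ bi) (sym eq) λ ())) (minOfPotentialCut⇔active (represents-oriented O eq))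

  I-unoriented : ∀ O e → e ∈ O ᵘ → Î G _≺_ (φ O) e ⇔ MinOfPotentialCut R _≺_ (insert (e , σᵘ e) O) e
  I-unoriented O e e∈ᵘ = ⇔-trans-sym
    (Î⇔active O e (subst (_≢ bi) (sym (status-ᵘ O e e∈ᵘ)) λ ()))
    (minOfPotentialCut⇔active (represents-insert O (status-ᵘ O e e∈ᵘ)))

  L-oriented : ∀ O e → e ∈ O ᵒ → L̂ G _≺_ (φ O) e ⇔ MinOfPotentialCycle R _≺_ O e
  L-oriented O e e∈ᵒ with status-ᵒ O e e∈ᵒ
  ... | δ , eq = ⇔-trans-sym (L̂⇔¬separated O e (subst (_≢ un) (sym eq) λ ()))
                          (minOfPotentialCycle⇔¬separated (represents-oriented O eq))

  L-bioriented : ∀ O e → e ∈ O ᵇ → L̂ G _≺_ (φ O) e ⇔ MinOfPotentialCycle R _≺_ (remove (e , σᵇ e) O) e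
  L-bioriented O e e∈ᵇ = ⇔-trans-sym
    (L̂⇔¬separated O e (subst (_≢ un) (sym (status-ᵇ O e e∈ᵇ)) λ ()))
    (minOfPotentialCycle⇔¬separated (represents-remove O (status-ᵇ O e e∈ᵇ)))
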